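{- For $h\ge 0$ let $\mathcal{S}_h(X)=\sum_{L\ge0}s(L,h)X^L$ (formal power series). Then $\mathcal{S}_0(X)=\dfrac{1}{1-X}$, $\mathcal{S}_1(X)=\dfrac{X}{(1-X)^2}$, and for all $h\ge2$, $$\mathcal{S}_h(X)=\frac{\mathcal{F}_h(X)}{(1-X^{h-1})(1-X^h)(1-X^{h+1})},$$ where $$\mathcal{F}_h(X)=(1-X^{h-1})\bigl(V_{2h,h}-V_{h,h}X^h-V_{h-1,h}X^{h+1}-X^{2h-1}\bigr)+(1+X)B_h,$$ $$V_{n,h}=\sum_{L=0}^{n-1}s(L,h)X^L,\qquad B_h=\sum_{r=0}^{h-2}s(h-1,r)X^{r+2h-1}.$$
   Context: For a finite word $w$ over $\{0,1\}$, $|w|$ is its length and $|w|_0,|w|_1$ are its numbers of $0$'s and $1$'s; $|w|_1$ is the height of $w$. A subword means a contiguous factor. A word $w$ is balanced if for all finite subwords $u,v$ of $w$ with $|u|=|v|$ one has $\bigl||u|_0-|v|_0\bigr|\le 1$. For $0\le h\le L$, $\mathbb{S}(L,h)$ is the set of balanced words in $\{0,1\}^*$ of length $L$ and height $h$. The function $s:\mathbb{Z}^2\to\mathbb{N}$ is defined by $s(L,h)=\#\mathbb{S}(L,h\bmod L)$ if $L>0$ (with $h\bmod L\in\{0,\dots,L-1\}$), $s(0,0)=1$, and $s(L,h)=0$ if $L<0$ or if $L=0$ and $h\ne0$. -}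

module Defs where

open import Algebra.Bundles.Raw using (RawRing)
import Algebra.Definitions
import Algebra.Definitions.RawMonoid
import Algebra.Definitions.RawSemiring
open import Data.Fin.Base using (Fin; toℕ)
open import Data.Fin.Patterns using (0F; 1F)
import Data.Fin.Properties as Fin
open import Data.Integer.Base as ℤ using (ℤ; +_; -[1+_])
open import Data.Integer.DivMod using (_%ℕ_)
import Data.Integer.Properties as ℤ
open import Data.List.Base using (List; []; _∷_; _++_; filter; length; map)
open import Data.List.Membership.Propositional using (_∈_)
open import Data.List.Membership.Propositional.Properties
  using (∈-++⁺ˡ; ∈-++⁺ʳ; ∈-map⁺; ∈-map⁻)
open import Data.List.Properties using (∷-injectiveʳ)
open import Data.List.Relation.Binary.Infix.Heterogeneous using (Infix; here; there)
open import Data.List.Relation.Binary.Prefix.Heterogeneous using (Prefix; []; _∷_)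
open import Data.List.Relation.Unary.Any using (here)
open import Data.List.Relation.Unary.All using ([])
open import Data.List.Relation.Unary.AllPairs using ([]; _∷_)
open import Data.List.Relation.Unary.Unique.Propositional using (Unique)
open import Data.List.Relation.Unary.Unique.Propositional.Properties using (++⁺; map⁺)
open import Data.Nat.Base as ℕ using (ℕ; zero; suc; ∣_-_∣)
import Data.Nat.Properties as ℕ
open import Data.Product.Base using (Σ-syntax; _×_; _,_; proj₁)
open import Level using (0ℓ)
open import Relation.Binary.PropositionalEquality using (_≡_; refl)
open import Relation.Nullary.Decidable using (Dec; map′; _×-dec_; _→-dec_)
open import Relation.Unary using (Pred; Decidable)

Word : Set
Word = List (Fin 2)

∣_∣₀ ∣_∣₁ : Word → ℕ
∣ w ∣₀ = length (filter (0F Fin.≟_) w)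
∣ w ∣₁ = length (filter (1F Fin.≟_) w)

Subword : Word → Word → Set
Subword = Infix _≡_

Balanced : Word → Set
Balanced w = ∀ u → Subword u w → ∀ v → Subword v w →
             length u ≡ length v → ∣ ∣ u ∣₀ - ∣ v ∣₀ ∣ ℕ.≤ 1

𝕊 : ℕ → ℕ → Pred Word 0ℓ
𝕊 L h w = length w ≡ L × ∣ w ∣₁ ≡ h × Balanced w

-- Cardinality of 𝕊 L h: Balanced is decidable because a word has only
-- finitely many subwords, and the words of length L can be enumerated.

allPrefixes? : ∀ {P : Pred Word 0ℓ} → Decidable P → ∀ w →
               Dec (∀ u → Prefix _≡_ u w → P u)
allPrefixes? P? []      = map′ (λ { p _ [] → p }) (λ f → f [] []) (P? [])
allPrefixes? P? (a ∷ w) = map′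
  (λ { (p , f) _ [] → p ; (p , f) _ (refl ∷ pr) → f _ pr })
  (λ f → f [] [] , λ u pr → f (a ∷ u) (refl ∷ pr))
  (P? [] ×-dec allPrefixes? (λ u → P? (a ∷ u)) w)

allSubwords? : ∀ {P : Pred Word 0ℓ} → Decidable P → ∀ w →
               Dec (∀ u → Subword u w → P u)
allSubwords? P? []      = map′
  (λ { f u (here pr) → f u pr }) (λ f u pr → f u (here pr)) (allPrefixes? P? [])
allSubwords? P? (a ∷ w) = map′
  (λ { (f , g) u (here pr) → f u pr ; (f , g) u (there i) → g u i })
  (λ f → (λ u pr → f u (here pr)) , λ u i → f u (there i))
  (allPrefixes? P? (a ∷ w) ×-dec allSubwords? P? w)

balanced? : Decidable Balanced
balanced? w = allSubwords? (λ u → allSubwords? (λ v →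
  (length u ℕ.≟ length v) →-dec (∣ ∣ u ∣₀ - ∣ v ∣₀ ∣ ℕ.≤? 1)) w) w

𝕊? : ∀ L h → Decidable (𝕊 L h)
𝕊? L h w = length w ℕ.≟ L ×-dec ∣ w ∣₁ ℕ.≟ h ×-dec balanced? w

words : ℕ → List Word
words zero    = [] ∷ []
words (suc L) = map (0F ∷_) (words L) ++ map (1F ∷_) (words L)

words-complete : ∀ w → w ∈ words (length w)
words-complete []       = here refl
words-complete (0F ∷ w) = ∈-++⁺ˡ (∈-map⁺ (0F ∷_) (words-complete w))
words-complete (1F ∷ w) = ∈-++⁺ʳ _ (∈-map⁺ (1F ∷_) (words-complete w))

words-unique : ∀ L → Unique (words L)
words-unique zero    = [] ∷ []
words-unique (suc L) = ++⁺ (map⁺ ∷-injectiveʳ (words-unique L))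
                           (map⁺ ∷-injectiveʳ (words-unique L)) disjoint
  where
  disjoint : ∀ {w} → w ∈ map (0F ∷_) (words L) × w ∈ map (1F ∷_) (words L) → _
  disjoint (p , q) with ∈-map⁻ (0F ∷_) p | ∈-map⁻ (1F ∷_) q
  ... | _ , _ , refl | _ , _ , ()

#𝕊 : ℕ → ℕ → ℕ
#𝕊 L h = length (filter (𝕊? L h) (words L))

s : ℤ → ℤ → ℕ
s (+ suc L) h     = #𝕊 (suc L) (h %ℕ suc L)
s (+ zero)  (+ 0) = 1
s (+ zero)  _     = 0
s -[1+ _ ]  _     = 0

PowerSeries : Set
PowerSeries = ℕ → ℤ

private
  module ℤ-Sum = Algebra.Definitions.RawMonoid ℤ.+-0-rawMonoid

const : ℤ → PowerSeries
const c zero    = c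
const c (suc _) = + 0

powerSeriesRawRing : RawRing 0ℓ 0ℓ
powerSeriesRawRing = record
  { Carrier = PowerSeries
  ; _≈_     = λ f g → ∀ n → f n ≡ g n
  ; _+_     = λ f g n → f n ℤ.+ g n
  ; _*_     = λ f g n → ℤ-Sum.sum λ (i : Fin (suc n)) → f (toℕ i) ℤ.* g (n ℕ.∸ toℕ i)
  ; -_      = λ f n → ℤ.- f n
  ; 0#      = const (+ 0)
  ; 1#      = const (+ 1)
  }

open RawRing powerSeriesRawRing public
  using (_≈_; _+_; _*_; -_; 0#; 1#; rawSemiring)
open Algebra.Definitions.RawSemiring rawSemiring public
  using (sum; _^_)
open Algebra.Definitions _≈_ public
  using (Invertible)

infixl 6 _-_
_-_ : PowerSeries → PowerSeries → PowerSeries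
f - g = f + (- g)

X : PowerSeries
X 1 = + 1
X _ = + 0

-- f equals the fraction g / d: the denominator is a unit of ℤ[[X]] and
-- f is g times its inverse.
infix 4 _≈_/_
_≈_/_ : PowerSeries → PowerSeries → PowerSeries → Set
f ≈ g / d = Σ[ d-unit ∈ Invertible 1# _*_ d ] f ≈ g * proj₁ d-unit

𝓢 : ℕ → PowerSeries
𝓢 h L = + s (+ L) (+ h)

V : ℕ → ℕ → PowerSeries
V n h = sum λ (L : Fin n) → const (+ s (+ toℕ L) (+ h)) * X ^ toℕ L

-- B and 𝓕 are meant for h ≥ 2, where no truncated subtraction below truncates.

B : ℕ → PowerSeries
B h = sum λ (r : Fin (h ℕ.∸ 1)) →
  const (+ s (+ (h ℕ.∸ 1)) (+ toℕ r)) * X ^ (toℕ r ℕ.+ 2 ℕ.* h ℕ.∸ 1)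

𝓕 : ℕ → PowerSeries
𝓕 h = (1# - X ^ (h ℕ.∸ 1))
        * (V (2 ℕ.* h) h - V h h * X ^ h - V (h ℕ.∸ 1) h * X ^ (h ℕ.+ 1) - X ^ (2 ℕ.* h ℕ.∸ 1))
      + (1# + X) * B h

{-# OPTIONS --safe #-}
module Submission where

-- Let T(z,h) be the number of balanced words with z zeros and h ones, and let
-- E_ab(z,h) count those with first letter a and last letter b.  A word is balanced
-- iff there is no p with both 1p1 and 0p0 among its subwords; consequently
-- Ψ(u) = θ(u)0, where θ : 0 ↦ 0, 1 ↦ 01, is balanced iff u is.  A balanced word
-- with no subword 11 stays balanced when a 0 is added next to each end letter 1,
-- and is then some Ψ(u).  Counting lengths,
--   E₀₀(z+h+1,h) = T(z,h),  E₁₀(z+h,h) = E₁₀(z,h) + E₁₁(z,h),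
--   E₁₁(z+h-1,h) = E₁₁(z,h).
-- Exchanging 0 and 1 turns these into E₁₁(z,h) = s(h-1,z) and E₀₀(y,h) = s(y-1,h).
-- Since T = E₀₀ + 2E₁₀ + E₁₁ by reversal, for h ≥ 2 and L ≥ 2h
--   s(L,h) + s(L-2h-1,h) = s(L-h,h) + s(L-h-1,h) + s(h-1,L-1) + s(h-1,L-2),
-- and the generating function follows because s(h-1,-) has period h-1.

module BalancedWords where

  open import Defs using (Word; ∣_∣₀; ∣_∣₁; Subword; Balanced)
  open import Data.Empty using (⊥)
  open import Data.Fin.Base using (Fin; toℕ; opposite)
  open import Data.Fin.Patterns using (0F; 1F)
  open import Data.Fin.Properties using (opposite-involutive)
  open import Data.List.Base using ([]; _∷_; _∷ʳ_; length; map; reverse; head; last)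
  open import Data.List.Properties
    using (length-++; unfold-reverse; reverse-involutive; reverse-++; map-++; map-∘; map-id; map-cong; ∷-injectiveʳ)
  open import Data.List.Relation.Binary.Infix.Heterogeneous using (here; there; _ⁱ++_) renaming (map to mapⁱ)
  import Data.List.Relation.Binary.Infix.Heterogeneous.Properties as Infix
  open import Data.List.Relation.Binary.Permutation.Propositional.Properties using (↭-length; ↭-reverse; filter-↭)
  open import Data.List.Relation.Binary.Prefix.Heterogeneous using (Prefix; []; _∷_)
  open import Data.List.Relation.Binary.Suffix.Heterogeneous.Properties using (fromPrefix)
  open import Data.Maybe.Base using (just)
  open import Data.Nat.Base using (suc; _+_; _*_; _≤_; _<_; s≤s; z≤n; ∣_-_∣)
  open import Data.Nat.Properties
  open import Data.Nat.Tactic.RingSolver using (solve-∀)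
  open import Data.Product.Base using (∃-syntax; _×_; _,_)
  open import Data.Sum.Base using (_⊎_; inj₁; inj₂)
  open import Function.Base using (_∘_)
  open import Relation.Binary.PropositionalEquality
  open import Relation.Nullary using (¬_; contradiction)

  -- Subwords and letter counts under reversal and complement.

  infix 4 _⊑_
  _⊑_ : Word → Word → Set
  _⊑_ = Subword

  ⊑-reverse : ∀ {u w} → u ⊑ w → reverse u ⊑ reverse w
  ⊑-reverse (here p)          = Infix.fromSuffix (fromPrefix p)
  ⊑-reverse (there {b} {u} {w} i) =
    subst (reverse u ⊑_) (sym (unfold-reverse b w)) (⊑-reverse i ⁱ++ (b ∷ []))

  complement : Word → Word
  complement = map opposite

  complement-involutive : ∀ w → complement (complement w) ≡ w
  complement-involutive w =
    trans (sym (map-∘ w)) (trans (map-cong opposite-involutive w) (map-id w))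

  ⊑-complement : ∀ {u w} → u ⊑ w → complement u ⊑ complement w
  ⊑-complement = Infix.map⁺ opposite opposite ∘ mapⁱ (cong opposite)

  ∣∣₁-reverse : ∀ w → ∣ reverse w ∣₁ ≡ ∣ w ∣₁
  ∣∣₁-reverse w = ↭-length (filter-↭ _ (↭-reverse w))

  ∣∣₁-complement : ∀ w → ∣ complement w ∣₁ + ∣ w ∣₁ ≡ length w
  ∣∣₁-complement []       = refl
  ∣∣₁-complement (0F ∷ w) = cong suc (∣∣₁-complement w)
  ∣∣₁-complement (1F ∷ w) = trans (+-suc _ _) (cong suc (∣∣₁-complement w))

  ∣∣₀-∷ʳ0 : ∀ w → ∣ w ∷ʳ 0F ∣₀ ≡ suc ∣ w ∣₀
  ∣∣₀-∷ʳ0 []       = refl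
  ∣∣₀-∷ʳ0 (0F ∷ w) = cong suc (∣∣₀-∷ʳ0 w)
  ∣∣₀-∷ʳ0 (1F ∷ w) = ∣∣₀-∷ʳ0 w

  ∣∣₀-∷ʳ1 : ∀ w → ∣ w ∷ʳ 1F ∣₀ ≡ ∣ w ∣₀
  ∣∣₀-∷ʳ1 []       = refl
  ∣∣₀-∷ʳ1 (0F ∷ w) = cong suc (∣∣₀-∷ʳ1 w)
  ∣∣₀-∷ʳ1 (1F ∷ w) = ∣∣₀-∷ʳ1 w

  ∣∣₁-∷ʳ0 : ∀ w → ∣ w ∷ʳ 0F ∣₁ ≡ ∣ w ∣₁
  ∣∣₁-∷ʳ0 []       = refl
  ∣∣₁-∷ʳ0 (0F ∷ w) = ∣∣₁-∷ʳ0 w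
  ∣∣₁-∷ʳ0 (1F ∷ w) = cong suc (∣∣₁-∷ʳ0 w)

  length-∷ʳ : ∀ (w : Word) {a} → length (w ∷ʳ a) ≡ suc (length w)
  length-∷ʳ w = trans (length-++ w) (+-comm (length w) 1)

  -- The Coven-Hedlund criterion for balance.

  Clash : Word → Set
  Clash w = ∃[ p ] 1F ∷ p ∷ʳ 1F ⊑ w × 0F ∷ p ∷ʳ 0F ⊑ w

  balanced⇒¬clash : ∀ {w} → Balanced w → ¬ Clash w
  balanced⇒¬clash {w} bal (p , i , j) = <⇒≱ (≤-reflexive (sym ∣diff∣)) (bal _ i _ j same)
    where
    same : length (1F ∷ p ∷ʳ 1F) ≡ length (0F ∷ p ∷ʳ 0F)
    same = cong suc (trans (length-∷ʳ p) (sym (length-∷ʳ p)))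
    ∣diff∣ : ∣ ∣ 1F ∷ p ∷ʳ 1F ∣₀ - ∣ 0F ∷ p ∷ʳ 0F ∣₀ ∣ ≡ 2
    ∣diff∣ rewrite ∣∣₀-∷ʳ0 p | ∣∣₀-∷ʳ1 p | +-comm 2 ∣ p ∣₀ =
      ∣m-m+n∣≡n ∣ p ∣₀ 2

  -- Compare the numbers of 0's read so far in u and in v.  Whenever u falls one
  -- behind v we start recording p; p is complete when u falls two behind, and is
  -- discarded when u catches up.  In the first lemma, recording is in progress.
  mutual
    pending-clash : ∀ u v → length u ≡ length v → suc ∣ u ∣₀ ≤ ∣ v ∣₀ →
      (∃[ p ] Prefix _≡_ (p ∷ʳ 1F) u × Prefix _≡_ (p ∷ʳ 0F) v)
      ⊎ (∃[ p ] 1F ∷ p ∷ʳ 1F ⊑ u × 0F ∷ p ∷ʳ 0F ⊑ v)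
    pending-clash (0F ∷ u) (0F ∷ v) e (s≤s d) with pending-clash u v (suc-injective e) d
    ... | inj₁ (p , i , j) = inj₁ (0F ∷ p , refl ∷ i , refl ∷ j)
    ... | inj₂ (p , i , j) = inj₂ (p , there i , there j)
    pending-clash (1F ∷ u) (1F ∷ v) e d with pending-clash u v (suc-injective e) d
    ... | inj₁ (p , i , j) = inj₁ (1F ∷ p , refl ∷ i , refl ∷ j)
    ... | inj₂ (p , i , j) = inj₂ (p , there i , there j)
    pending-clash (1F ∷ u) (0F ∷ v) e d = inj₁ ([] , refl ∷ [] , refl ∷ [])
    pending-clash (0F ∷ u) (1F ∷ v) e d with clash u v (suc-injective e) d
    ... | p , i , j = inj₂ (p , there i , there j)

    clash : ∀ u v → length u ≡ length v → 2 + ∣ u ∣₀ ≤ ∣ v ∣₀ →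
      ∃[ p ] 1F ∷ p ∷ʳ 1F ⊑ u × 0F ∷ p ∷ʳ 0F ⊑ v
    clash (0F ∷ u) (0F ∷ v) e (s≤s d) with clash u v (suc-injective e) d
    ... | p , i , j = p , there i , there j
    clash (1F ∷ u) (1F ∷ v) e d with clash u v (suc-injective e) d
    ... | p , i , j = p , there i , there j
    clash (0F ∷ u) (1F ∷ v) e d with clash u v (suc-injective e) (≤-trans (n≤1+n _) d)
    ... | p , i , j = p , there i , there j
    clash (1F ∷ u) (0F ∷ v) e (s≤s d) with pending-clash u v (suc-injective e) d
    ... | inj₁ (p , i , j) = p , here (refl ∷ i) , here (refl ∷ j)
    ... | inj₂ (p , i , j) = p , there i , there j

  ⊑-trans : ∀ {u v w} → u ⊑ v → v ⊑ w → u ⊑ w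
  ⊑-trans = Infix.trans trans

  -- Whichever of u and v has fewer 0's supplies the factor 1p1 and the other supplies 0p0; a
  -- difference of two or more would thus put a clash into w.
  ¬clash⇒balanced : ∀ {w} → ¬ Clash w → Balanced w
  ¬clash⇒balanced {w} ¬c u i v j e with ≤-total ∣ u ∣₀ ∣ v ∣₀
  ... | inj₁ u≤v = ≮⇒≥ λ 1<d →
    let d = subst (2 ≤_) (m≤n⇒∣m-n∣≡n∸m u≤v) 1<d
        p , k , l = clash u v e (≤-trans (+-monoˡ-≤ _ d) (≤-reflexive (m∸n+n≡m u≤v)))
    in ¬c (p , ⊑-trans k i , ⊑-trans l j)
  ... | inj₂ v≤u = ≮⇒≥ λ 1<d →
    let d = subst (2 ≤_) (m≤n⇒∣n-m∣≡n∸m v≤u) 1<d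
        p , k , l = clash v u (sym e) (≤-trans (+-monoˡ-≤ _ d) (≤-reflexive (m∸n+n≡m v≤u)))
    in ¬c (p , ⊑-trans k j , ⊑-trans l i)

  balanced-⊑ : ∀ {v w} → v ⊑ w → Balanced w → Balanced v
  balanced-⊑ i bal u j u′ j′ = bal u (⊑-trans j i) u′ (⊑-trans j′ i)

  reverse-∷∷ʳ : ∀ (a b : Fin 2) p → reverse (a ∷ p ∷ʳ b) ≡ b ∷ reverse p ∷ʳ a
  reverse-∷∷ʳ a b p = trans (unfold-reverse a (p ∷ʳ b)) (cong (_∷ʳ a) (reverse-++ p (b ∷ [])))

  reverse-balanced : ∀ {w} → Balanced w → Balanced (reverse w)
  reverse-balanced {w} bal = ¬clash⇒balanced λ (p , i , j) →
    balanced⇒¬clash bal (reverse p , back i , back j)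
    where
    back : ∀ {a b p} → a ∷ p ∷ʳ b ⊑ reverse w → b ∷ reverse p ∷ʳ a ⊑ w
    back {p = p} i = subst₂ _⊑_ (reverse-∷∷ʳ _ _ p) (reverse-involutive w) (⊑-reverse i)

  -- Complementing exchanges the factors 1p1 and 0p0, so a clash comes back as a clash with the two
  -- roles swapped.
  complement-balanced : ∀ {w} → Balanced w → Balanced (complement w)
  complement-balanced {w} bal = ¬clash⇒balanced λ (p , i , j) →
    balanced⇒¬clash bal (complement p , back j , back i)
    where
    back : ∀ {a b p} → a ∷ p ∷ʳ b ⊑ complement w → opposite a ∷ complement p ∷ʳ opposite b ⊑ w
    back {a} {b} {p} i = subst₂ _⊑_ (cong (_ ∷_) (map-++ opposite p (b ∷ []))) (complement-involutive w) (⊑-complement i)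

  -- The substitution `Ψ` preserves and reflects balance.

  Ψ : Word → Word
  Ψ []       = 0F ∷ []
  Ψ (0F ∷ u) = 0F ∷ Ψ u
  Ψ (1F ∷ u) = 0F ∷ 1F ∷ Ψ u

  Ψ-∷ : ∀ u → ∃[ v ] Ψ u ≡ 0F ∷ v
  Ψ-∷ []       = _ , refl
  Ψ-∷ (0F ∷ u) = _ , refl
  Ψ-∷ (1F ∷ u) = _ , refl

  Ψ-injective : ∀ {u v} → Ψ u ≡ Ψ v → u ≡ v
  Ψ-injective {[]} {[]} e = refl
  Ψ-injective {[]} {0F ∷ v} e with Ψ v | Ψ-∷ v
  Ψ-injective {[]} {0F ∷ v} () | _ | _ , refl
  Ψ-injective {[]} {1F ∷ v} ()
  Ψ-injective {0F ∷ u} {[]} e with Ψ u | Ψ-∷ u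
  Ψ-injective {0F ∷ u} {[]} () | _ | _ , refl
  Ψ-injective {0F ∷ u} {0F ∷ v} e = cong (0F ∷_) (Ψ-injective (∷-injectiveʳ e))
  Ψ-injective {1F ∷ u} {1F ∷ v} e = cong (1F ∷_) (Ψ-injective (∷-injectiveʳ (∷-injectiveʳ e)))
  Ψ-injective {0F ∷ u} {1F ∷ v} e with Ψ u | Ψ-∷ u
  Ψ-injective {0F ∷ u} {1F ∷ v} () | _ | _ , refl
  Ψ-injective {1F ∷ u} {0F ∷ v} e with Ψ v | Ψ-∷ v
  Ψ-injective {1F ∷ u} {0F ∷ v} () | _ | _ , refl

  -- After θ(q) the letter 1 contributes its block 01, and the letter 0 contributes 0 followed by
  -- the 0 that opens the rest. Either way θ(q) continues with 0a, and θ(q)0 is `Ψ q`.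
  Ψ-prefix⁺ : ∀ a q {u} → Prefix _≡_ (q ∷ʳ a) u → Prefix _≡_ (Ψ q ∷ʳ a) (Ψ u)
  Ψ-prefix⁺ a (0F ∷ q) (refl ∷ i) = refl ∷ Ψ-prefix⁺ a q i
  Ψ-prefix⁺ a (1F ∷ q) (refl ∷ i) = refl ∷ refl ∷ Ψ-prefix⁺ a q i
  Ψ-prefix⁺ 1F [] (refl ∷ i) = refl ∷ refl ∷ []
  Ψ-prefix⁺ 0F [] {_ ∷ u} (refl ∷ i) with Ψ u | Ψ-∷ u
  ... | _ | _ , refl = refl ∷ refl ∷ []

  Ψ-1⊑1 : ∀ q {u} → 1F ∷ q ∷ʳ 1F ⊑ u → 1F ∷ Ψ q ∷ʳ 1F ⊑ Ψ u
  Ψ-1⊑1 q {_} (here (refl ∷ i)) = there (here (refl ∷ Ψ-prefix⁺ 1F q i))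
  Ψ-1⊑1 q {0F ∷ u} (there i) = there (Ψ-1⊑1 q i)
  Ψ-1⊑1 q {1F ∷ u} (there i) = there (there (Ψ-1⊑1 q i))

  Ψ-0⊑0 : ∀ q {u} → 0F ∷ q ∷ʳ 0F ⊑ u → 0F ∷ Ψ q ∷ʳ 0F ⊑ Ψ u
  Ψ-0⊑0 q {_} (here (refl ∷ i)) = here (refl ∷ Ψ-prefix⁺ 0F q i)
  Ψ-0⊑0 q {0F ∷ u} (there i) = there (Ψ-0⊑0 q i)
  Ψ-0⊑0 q {1F ∷ u} (there i) = there (there (Ψ-0⊑0 q i))

  -- In `Ψ u` every 1 closes a block 01, so what precedes it is θ(q)0 for a prefix q of u whose next
  -- letter is 1.
  Ψ-prefix1⁻ : ∀ p u → Prefix _≡_ (p ∷ʳ 1F) (Ψ u) → ∃[ q ] p ≡ Ψ q × Prefix _≡_ (q ∷ʳ 1F) u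
  Ψ-prefix1⁻ [] u i with Ψ u | Ψ-∷ u
  Ψ-prefix1⁻ [] u (() ∷ i) | _ | _ , refl
  Ψ-prefix1⁻ (_ ∷ []) [] (_ ∷ ())
  Ψ-prefix1⁻ (_ ∷ _ ∷ _) [] (_ ∷ ())
  Ψ-prefix1⁻ (_ ∷ p) (0F ∷ u) (refl ∷ i) with Ψ-prefix1⁻ p u i
  ... | q , refl , j = 0F ∷ q , refl , refl ∷ j
  Ψ-prefix1⁻ (_ ∷ []) (1F ∷ u) (refl ∷ _) = [] , refl , refl ∷ []
  Ψ-prefix1⁻ (_ ∷ _ ∷ p) (1F ∷ u) (refl ∷ refl ∷ i) with Ψ-prefix1⁻ p u i
  ... | q , refl , j = 1F ∷ q , refl , refl ∷ j

  -- The blocks of q and u are matched one by one. After θ(q) comes 00, which neither the block 01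
  -- nor the closing 0 of `Ψ u` can begin, so the next letter of u is 0.
  Ψ-prefix0⁻ : ∀ q u → Prefix _≡_ (Ψ q ∷ʳ 0F) (Ψ u) → Prefix _≡_ (q ∷ʳ 0F) u
  Ψ-prefix0⁻ [] [] (_ ∷ ())
  Ψ-prefix0⁻ [] (0F ∷ u) i = refl ∷ []
  Ψ-prefix0⁻ [] (1F ∷ u) (_ ∷ () ∷ _)
  Ψ-prefix0⁻ (0F ∷ q) [] (_ ∷ i) with Ψ q | Ψ-∷ q
  Ψ-prefix0⁻ (0F ∷ q) [] (_ ∷ ()) | _ | _ , refl
  Ψ-prefix0⁻ (0F ∷ q) (0F ∷ u) (_ ∷ i) = refl ∷ Ψ-prefix0⁻ q u i
  Ψ-prefix0⁻ (0F ∷ q) (1F ∷ u) (_ ∷ i) with Ψ q | Ψ-∷ q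
  Ψ-prefix0⁻ (0F ∷ q) (1F ∷ u) (_ ∷ () ∷ _) | _ | _ , refl
  Ψ-prefix0⁻ (1F ∷ q) [] (_ ∷ ())
  Ψ-prefix0⁻ (1F ∷ q) (0F ∷ u) (_ ∷ i) with Ψ u | Ψ-∷ u
  Ψ-prefix0⁻ (1F ∷ q) (0F ∷ u) (_ ∷ () ∷ _) | _ | _ , refl
  Ψ-prefix0⁻ (1F ∷ q) (1F ∷ u) (_ ∷ _ ∷ i) = refl ∷ Ψ-prefix0⁻ q u i

  Ψ-1⊑1⁻ : ∀ p u → 1F ∷ p ∷ʳ 1F ⊑ Ψ u → ∃[ q ] p ≡ Ψ q × 1F ∷ q ∷ʳ 1F ⊑ u
  Ψ-1⊑1⁻ p [] (here (() ∷ _))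
  Ψ-1⊑1⁻ p [] (there (here ()))
  Ψ-1⊑1⁻ p (0F ∷ u) (here (() ∷ _))
  Ψ-1⊑1⁻ p (1F ∷ u) (here (() ∷ _))
  Ψ-1⊑1⁻ p (0F ∷ u) (there i) with Ψ-1⊑1⁻ p u i
  ... | q , e , j = q , e , there j
  Ψ-1⊑1⁻ p (1F ∷ u) (there (there i)) with Ψ-1⊑1⁻ p u i
  ... | q , e , j = q , e , there j
  Ψ-1⊑1⁻ p (1F ∷ u) (there (here (_ ∷ i))) with Ψ-prefix1⁻ p u i
  ... | q , e , j = q , e , here (refl ∷ j)

  -- Since `Ψ q` begins with 0, the factor begins with 00; its first letter is therefore the whole
  -- block of a letter 0 of u.
  Ψ-0⊑0⁻ : ∀ q u → 0F ∷ Ψ q ∷ʳ 0F ⊑ Ψ u → 0F ∷ q ∷ʳ 0F ⊑ u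
  Ψ-0⊑0⁻ q [] (here (_ ∷ i)) with Ψ q
  Ψ-0⊑0⁻ q [] (here (_ ∷ ())) | []
  Ψ-0⊑0⁻ q [] (here (_ ∷ ())) | _ ∷ _
  Ψ-0⊑0⁻ q [] (there (here ()))
  Ψ-0⊑0⁻ q (0F ∷ u) (here (_ ∷ i)) = here (refl ∷ Ψ-prefix0⁻ q u i)
  Ψ-0⊑0⁻ q (0F ∷ u) (there i) = there (Ψ-0⊑0⁻ q u i)
  Ψ-0⊑0⁻ q (1F ∷ u) (here (_ ∷ i)) with Ψ q | Ψ-∷ q
  Ψ-0⊑0⁻ q (1F ∷ u) (here (_ ∷ () ∷ _)) | _ | _ , refl
  Ψ-0⊑0⁻ q (1F ∷ u) (there (here (() ∷ _)))
  Ψ-0⊑0⁻ q (1F ∷ u) (there (there i)) = there (Ψ-0⊑0⁻ q u i)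

  -- The factor 1p1 of a clash in `Ψ u` forces p to be some `Ψ q`, and then the clash comes from a
  -- clash of q in u.
  Ψ-balanced⁺ : ∀ {u} → Balanced u → Balanced (Ψ u)
  Ψ-balanced⁺ {u} bal = ¬clash⇒balanced λ (p , i , j) → go p (Ψ-1⊑1⁻ p u i) j
    where
    go : ∀ p → ∃[ q ] p ≡ Ψ q × 1F ∷ q ∷ʳ 1F ⊑ u → 0F ∷ p ∷ʳ 0F ⊑ Ψ u → ⊥
    go _ (q , refl , i) j = balanced⇒¬clash bal (q , i , Ψ-0⊑0⁻ q u j)

  Ψ-balanced⁻ : ∀ {u} → Balanced (Ψ u) → Balanced u
  Ψ-balanced⁻ bal = ¬clash⇒balanced λ (q , i , j) →
    balanced⇒¬clash bal (Ψ q , Ψ-1⊑1 q i , Ψ-0⊑0 q j)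

  ∣Ψ∣₁ : ∀ u → ∣ Ψ u ∣₁ ≡ ∣ u ∣₁
  ∣Ψ∣₁ []       = refl
  ∣Ψ∣₁ (0F ∷ u) = ∣Ψ∣₁ u
  ∣Ψ∣₁ (1F ∷ u) = cong suc (∣Ψ∣₁ u)

  length-Ψ : ∀ u → length (Ψ u) ≡ suc (length u + ∣ u ∣₁)
  length-Ψ []       = refl
  length-Ψ (0F ∷ u) = cong suc (length-Ψ u)
  length-Ψ (1F ∷ u) = cong (suc ∘ suc) (trans (length-Ψ u) (sym (+-suc _ _)))

  -- Words without 11 and the image of `Ψ`.

  No11 : Word → Set
  No11 w = ¬ (1F ∷ 1F ∷ [] ⊑ w)

  no11-∷⁻ : ∀ {a w} → No11 (a ∷ w) → No11 w
  no11-∷⁻ no i = no (there i)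

  -- Cutting before every 0 leaves only blocks 0 and 01, since no block can contain two 1's; the
  -- last 0 is the one that `Ψ` appends.
  Ψ-surjective : ∀ v → head (v ∷ʳ 0F) ≡ just 0F → No11 (v ∷ʳ 0F) → ∃[ u ] Ψ u ≡ v ∷ʳ 0F
  Ψ-surjective []           _ _  = [] , refl
  Ψ-surjective (0F ∷ [])    _ _  = 0F ∷ [] , refl
  Ψ-surjective (0F ∷ 0F ∷ v) _ no with Ψ-surjective (0F ∷ v) refl (no11-∷⁻ no)
  ... | u , e = 0F ∷ u , cong (0F ∷_) e
  Ψ-surjective (0F ∷ 1F ∷ []) _ no = 1F ∷ [] , refl
  Ψ-surjective (0F ∷ 1F ∷ 1F ∷ v) _ no = contradiction (there (here (refl ∷ refl ∷ []))) no
  Ψ-surjective (0F ∷ 1F ∷ 0F ∷ v) _ no with Ψ-surjective (0F ∷ v) refl (no11-∷⁻ (no11-∷⁻ no))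
  ... | u , e = 1F ∷ u , cong (λ w → 0F ∷ 1F ∷ w) e

  -- A clash through the new letter would be 0p0 with p = 1p′, but then 1p1 = 11p′1.
  0∷-balanced : ∀ {w} → No11 (1F ∷ w) → Balanced (1F ∷ w) → Balanced (0F ∷ 1F ∷ w)
  0∷-balanced no bal = ¬clash⇒balanced λ where
    (_ , there i , there j)                          → balanced⇒¬clash bal (_ , i , j)
    (_ , here (() ∷ _) , _)
    ([] , _ , here (_ ∷ () ∷ _))
    (1F ∷ p , there i , here (_ ∷ refl ∷ _)) → no (⊑-trans (here (refl ∷ refl ∷ [])) i)

  no11-reverse : ∀ {w} → No11 w → No11 (reverse w)
  no11-reverse {w} no i = no (subst (_ ⊑_) (reverse-involutive w) (⊑-reverse i))

  last-∷ʳ : ∀ (w : Word) a → last (w ∷ʳ a) ≡ just a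
  last-∷ʳ []          a = refl
  last-∷ʳ (_ ∷ [])    a = refl
  last-∷ʳ (_ ∷ y ∷ w) a = last-∷ʳ (y ∷ w) a

  last≡just : ∀ (w : Word) {a} → last w ≡ just a → ∃[ v ] w ≡ v ∷ʳ a
  last≡just (x ∷ [])    refl = [] , refl
  last≡just (x ∷ y ∷ w) e with last≡just (y ∷ w) e
  ... | v , e′ = x ∷ v , cong (x ∷_) e′

  head≡just : ∀ (w : Word) {a} → head w ≡ just a → ∃[ v ] w ≡ a ∷ v
  head≡just (_ ∷ v) refl = v , refl

  -- Length bounds that exclude 11.

  No00 : Word → Set
  No00 w = ¬ (0F ∷ 0F ∷ [] ⊑ w)

  -- Without 00 the 0's are separated by 1's, so there is at most one more 0 than there are 1's, and
  -- each end letter 1 lowers this bound by one. The left side is the length of the word, less one,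
  -- plus the number of ends that are 1.
  no00-length : ∀ a {b} w → last (a ∷ w) ≡ just b → No00 (a ∷ w) →
                length w + toℕ a + toℕ b ≤ 2 * ∣ a ∷ w ∣₁
  no00-length 0F [] refl no = z≤n
  no00-length 1F [] refl no = s≤s (s≤s z≤n)
  no00-length 0F (0F ∷ w) e no = contradiction (here (refl ∷ refl ∷ [])) no
  no00-length 0F {b} (1F ∷ w) e no = ≤-trans (≤-reflexive (lem (length w) (toℕ b))) (no00-length 1F w e (no ∘ there))
    where
    lem : ∀ l b → suc l + 0 + b ≡ l + 1 + b
    lem = solve-∀
  no00-length 1F {b} (x ∷ w) e no = ≤-trans (lem (length w) (toℕ x) (toℕ b))
    (≤-trans (+-monoʳ-≤ 2 (no00-length x w e (no ∘ there))) (≤-reflexive (sym (*-distribˡ-+ 2 1 ∣ x ∷ w ∣₁))))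
    where
    lem : ∀ l x b → suc l + 1 + b ≤ 2 + (l + x + b)
    lem l x b = ≤-trans (≤-reflexive (lem′ l b)) (+-monoʳ-≤ 2 (+-monoˡ-≤ b (m≤m+n l x)))
      where
      lem′ : ∀ l b → suc l + 1 + b ≡ 2 + (l + b)
      lem′ = solve-∀

  -- A factor 11 leaves one gap between consecutive 1's without a 0, which improves the previous
  -- bound by one.
  no00-11-length : ∀ a {b} w → last (a ∷ w) ≡ just b → No00 (a ∷ w) → 1F ∷ 1F ∷ [] ⊑ a ∷ w →
                suc (length w + toℕ a + toℕ b) ≤ 2 * ∣ a ∷ w ∣₁
  no00-11-length _ {b} (x ∷ w) e no (here (refl ∷ refl ∷ _)) =
    ≤-trans (≤-reflexive (lem (length w) (toℕ b)))
      (≤-trans (+-monoʳ-≤ 2 (no00-length 1F w e (no ∘ there))) (≤-reflexive (sym (*-distribˡ-+ 2 1 ∣ 1F ∷ w ∣₁))))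
    where
    lem : ∀ l b → suc (suc l + 1 + b) ≡ 2 + (l + 1 + b)
    lem = solve-∀
  no00-11-length a [] e no (here (_ ∷ ()))
  no00-11-length a [] e no (there (here ()))
  no00-11-length 0F (0F ∷ w) e no (there i) = contradiction (here (refl ∷ refl ∷ [])) no
  no00-11-length 0F {b} (1F ∷ w) e no (there i) =
    ≤-trans (≤-reflexive (lem (length w) (toℕ b))) (no00-11-length 1F w e (no ∘ there) i)
    where
    lem : ∀ l b → suc (suc l + 0 + b) ≡ suc (l + 1 + b)
    lem = solve-∀
  no00-11-length 1F {b} (x ∷ w) e no (there i) = ≤-trans (lem (length w) (toℕ x) (toℕ b))
    (≤-trans (+-monoʳ-≤ 2 (no00-11-length x w e (no ∘ there) i)) (≤-reflexive (sym (*-distribˡ-+ 2 1 ∣ x ∷ w ∣₁))))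
    where
    lem : ∀ l x b → suc (suc l + 1 + b) ≤ 2 + suc (l + x + b)
    lem l x b = ≤-trans (≤-reflexive (lem′ l b)) (+-monoʳ-≤ 3 (+-monoˡ-≤ b (m≤m+n l x)))
      where
      lem′ : ∀ l b → suc (suc l + 1 + b) ≡ 3 + (l + b)
      lem′ = solve-∀

  -- The factors 11 and 00 form a clash with p empty. A balanced word containing 11 thus avoids 00
  -- and is too short for the hypothesis.
  balanced-no11 : ∀ w {a b} → head w ≡ just a → last w ≡ just b → Balanced w →
                  2 * ∣ w ∣₁ < length w + toℕ a + toℕ b → No11 w
  balanced-no11 (a ∷ w) refl e bal long i =
    <⇒≱ long (no00-11-length a w e (λ j → balanced⇒¬clash bal ([] , i , j)) i)

module Counting where

  open BalancedWords
  open import Defs using (Word; ∣_∣₁; Balanced; 𝕊; 𝕊?; #𝕊; words; words-complete; words-unique; s)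
  open import Data.Fin.Base using (Fin; opposite)
  open import Data.Fin.Patterns using (0F; 1F)
  open import Data.Fin.Properties using (opposite-involutive) renaming (_≟_ to _≟ᶠ_)
  import Data.Integer.Base as ℤ
  open import Data.List.Base using ([]; _∷_; _∷ʳ_; length; map; reverse; filter; head; last)
  open import Data.List.Membership.Propositional using (_∈_)
  open import Data.List.Membership.Propositional.Properties using (∈-filter⁺; ∈-filter⁻; ∈-map⁺; ∈-map⁻)
  open import Data.List.Membership.Propositional.Properties.WithK using (unique∧set⇒bag)
  open import Data.List.Properties
    using (unfold-reverse; reverse-involutive; reverse-++; length-reverse; length-map;
           reverse-injective; head-map; last-map; ∷ʳ-injectiveˡ; ∷-injectiveʳ)
  open import Data.List.Relation.Binary.BagAndSetEquality using (∼bag⇒↭)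
  open import Data.List.Relation.Binary.Infix.Heterogeneous using (here; there; _ⁱ++_)
  open import Data.List.Relation.Binary.Infix.Heterogeneous.Properties using (fromPointwise)
  import Data.List.Relation.Binary.Pointwise as Pointwise
  open import Data.List.Relation.Binary.Prefix.Heterogeneous using (_∷_)
  open import Data.List.Relation.Binary.Permutation.Propositional.Properties using (↭-length)
  open import Data.List.Relation.Unary.Unique.Propositional.Properties using (filter⁺; map⁺)
  open import Data.Maybe.Base using (just)
  import Data.Maybe.Base as Maybe
  open import Data.Maybe.Properties using (≡-dec)
  open import Data.Nat.Base using (ℕ; zero; suc; _+_; _*_; _∸_; _<_; s≤s; z≤n; _%_; _/_)
  open import Data.Nat.DivMod using (m≡m%n+[m/n]*n; m%n<n; m<n⇒m%n≡m; n%n≡0; [m+n]%n≡m%n)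
  open import Data.Nat.Properties
  open import Data.Nat.Tactic.RingSolver using (solve-∀)
  open import Data.Product.Base using (∃-syntax; _×_; _,_; proj₁; proj₂)
  open import Data.Sum.Base using (_⊎_; inj₁; inj₂; [_,_]′)
  open import Function.Base using (_∘_; id)
  open import Function.Bundles using (mk⇔)
  open import Relation.Binary.PropositionalEquality
  open import Relation.Nullary using (¬_; contradiction; yes; no)
  open import Relation.Nullary.Decidable using (_×-dec_)
  open import Relation.Unary using (Pred; Decidable)
  open import Level using (0ℓ)

  -- Comparing cardinalities of finite sets of words.

  count : {P : Pred Word 0ℓ} → Decidable P → ℕ → ℕ
  count P? n = length (filter P? (words n))

  ∈-words : ∀ {w n} → length w ≡ n → w ∈ words n
  ∈-words {w} refl = words-complete w

  -- Two injections with the same image replace a map and its inverse. This suits comparisons such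
  -- as `Ψ u` against 0w0, where an inverse would have to strip letters. Duplicate-free lists with
  -- the same members are permutations of each other.
  count-bij : {P Q : Pred Word 0ℓ} (P? : Decidable P) (Q? : Decidable Q) {m n : ℕ} (f g : Word → Word) →
    (∀ {v w} → f v ≡ f w → v ≡ w) → (∀ {v w} → g v ≡ g w → v ≡ w) →
    (∀ w → P w → length w ≡ m) → (∀ w → Q w → length w ≡ n) →
    (∀ v → P v → ∃[ w ] Q w × f v ≡ g w) → (∀ w → Q w → ∃[ v ] P v × f v ≡ g w) →
    count P? m ≡ count Q? n
  count-bij P? Q? {m} {n} f g f-inj g-inj ∣P∣ ∣Q∣ to from = begin
    length Ps         ≡⟨ length-map f Ps ⟨
    length (map f Ps) ≡⟨ ↭-length (∼bag⇒↭ (unique∧set⇒bag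
                           (map⁺ f-inj (filter⁺ P? (words-unique m)))
                           (map⁺ g-inj (filter⁺ Q? (words-unique n)))
                           (mk⇔ to′ from′))) ⟩
    length (map g Qs) ≡⟨ length-map g Qs ⟩
    length Qs         ∎
    where
    open ≡-Reasoning
    Ps = filter P? (words m)
    Qs = filter Q? (words n)
    to′ : ∀ {x} → x ∈ map f Ps → x ∈ map g Qs
    to′ i with v , v∈ , refl ← ∈-map⁻ f i
          with w , q , e ← to v (proj₂ (∈-filter⁻ P? {xs = words m} v∈)) =
      subst (_∈ map g Qs) (sym e) (∈-map⁺ g (∈-filter⁺ Q? (∈-words (∣Q∣ w q)) q))
    from′ : ∀ {x} → x ∈ map g Qs → x ∈ map f Ps
    from′ i with w , w∈ , refl ← ∈-map⁻ g i
            with v , p , e ← from w (proj₂ (∈-filter⁻ Q? {xs = words n} w∈)) =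
      subst (_∈ map f Ps) e (∈-map⁺ f (∈-filter⁺ P? (∈-words (∣P∣ v p)) p))

  count-⊎ : {P Q R : Pred Word 0ℓ} (P? : Decidable P) (Q? : Decidable Q) (R? : Decidable R) →
    (∀ w → P w → Q w ⊎ R w) → (∀ w → Q w → P w) → (∀ w → R w → P w) → (∀ w → Q w → ¬ R w) →
    ∀ n → count P? n ≡ count Q? n + count R? n
  count-⊎ P? Q? R? split Q⇒P R⇒P disj n = go (words n)
    where
    go : ∀ ws → length (filter P? ws) ≡ length (filter Q? ws) + length (filter R? ws)
    go [] = refl
    go (w ∷ ws) with P? w | Q? w | R? w
    ... | _     | yes q | yes r = contradiction r (disj w q)
    ... | yes _ | yes _ | no _  = cong suc (go ws)
    ... | yes _ | no _  | yes _ = trans (cong suc (go ws)) (sym (+-suc _ _))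
    ... | yes p | no ¬q | no ¬r = contradiction (split w p) [ ¬q , ¬r ]′
    ... | no ¬p | yes q | no _  = contradiction (Q⇒P w q) ¬p
    ... | no ¬p | no _  | yes r = contradiction (R⇒P w r) ¬p
    ... | no _  | no _  | no _  = go ws

  count-empty : {P : Pred Word 0ℓ} (P? : Decidable P) → (∀ w → ¬ P w) → ∀ n → count P? n ≡ 0
  count-empty P? ¬P n = go (words n)
    where
    go : ∀ ws → length (filter P? ws) ≡ 0
    go []       = refl
    go (w ∷ ws) with P? w
    ... | yes p = contradiction p (¬P w)
    ... | no _  = go ws

  -- Counts by end letters and their symmetries.

  𝕊⟨_∙⟩ : Fin 2 → ℕ → ℕ → Pred Word 0ℓ
  𝕊⟨ a ∙⟩ L h w = 𝕊 L h w × head w ≡ just a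

  𝕊⟨_,_⟩ : Fin 2 → Fin 2 → ℕ → ℕ → Pred Word 0ℓ
  𝕊⟨ a , b ⟩ L h w = 𝕊⟨ a ∙⟩ L h w × last w ≡ just b

  𝕊⟨_∙⟩? : ∀ a L h → Decidable (𝕊⟨ a ∙⟩ L h)
  𝕊⟨ a ∙⟩? L h w = 𝕊? L h w ×-dec ≡-dec _≟ᶠ_ (head w) (just a)

  𝕊⟨_,_⟩? : ∀ a b L h → Decidable (𝕊⟨ a , b ⟩ L h)
  𝕊⟨ a , b ⟩? L h w = 𝕊⟨ a ∙⟩? L h w ×-dec ≡-dec _≟ᶠ_ (last w) (just b)

  -- In #⟨ a , b ⟩ z h and its variants, z is the number of 0's and h that of 1's.

  #⟨∙,∙⟩ : ℕ → ℕ → ℕ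
  #⟨∙,∙⟩ z h = #𝕊 (z + h) h

  #⟨_,∙⟩ : Fin 2 → ℕ → ℕ → ℕ
  #⟨ a ,∙⟩ z h = count (𝕊⟨ a ∙⟩? (z + h) h) (z + h)

  #⟨_,_⟩ : Fin 2 → Fin 2 → ℕ → ℕ → ℕ
  #⟨ a , b ⟩ z h = count (𝕊⟨ a , b ⟩? (z + h) h) (z + h)

  #-head : ∀ z h → 0 < z + h → #⟨∙,∙⟩ z h ≡ #⟨ 0F ,∙⟩ z h + #⟨ 1F ,∙⟩ z h
  #-head z h 0<L = count-⊎ (𝕊? (z + h) h) (𝕊⟨ 0F ∙⟩? (z + h) h) (𝕊⟨ 1F ∙⟩? (z + h) h)
    split (λ _ → proj₁) (λ _ → proj₁) disj (z + h)
    where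
    split : ∀ w → 𝕊 (z + h) h w → 𝕊⟨ 0F ∙⟩ (z + h) h w ⊎ 𝕊⟨ 1F ∙⟩ (z + h) h w
    split []       (e , _) = contradiction e (<⇒≢ 0<L)
    split (0F ∷ _) p       = inj₁ (p , refl)
    split (1F ∷ _) p       = inj₂ (p , refl)
    disj : ∀ w → 𝕊⟨ 0F ∙⟩ (z + h) h w → ¬ 𝕊⟨ 1F ∙⟩ (z + h) h w
    disj w (_ , e) (_ , e′) with () ← trans (sym e) e′

  last-letter : ∀ (x : Fin 2) w → last (x ∷ w) ≡ just 0F ⊎ last (x ∷ w) ≡ just 1F
  last-letter 0F []      = inj₁ refl
  last-letter 1F []      = inj₂ refl
  last-letter _  (x ∷ w) = last-letter x w

  #-last : ∀ a z h → #⟨ a ,∙⟩ z h ≡ #⟨ a , 0F ⟩ z h + #⟨ a , 1F ⟩ z h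
  #-last a z h = count-⊎ (𝕊⟨ a ∙⟩? (z + h) h) (𝕊⟨ a , 0F ⟩? (z + h) h) (𝕊⟨ a , 1F ⟩? (z + h) h)
    split (λ _ → proj₁) (λ _ → proj₁) disj (z + h)
    where
    split : ∀ w → 𝕊⟨ a ∙⟩ (z + h) h w → 𝕊⟨ a , 0F ⟩ (z + h) h w ⊎ 𝕊⟨ a , 1F ⟩ (z + h) h w
    split (x ∷ w) p with last-letter x w
    ... | inj₁ e = inj₁ (p , e)
    ... | inj₂ e = inj₂ (p , e)
    disj : ∀ w → 𝕊⟨ a , 0F ⟩ (z + h) h w → ¬ 𝕊⟨ a , 1F ⟩ (z + h) h w
    disj w (_ , e) (_ , e′) with () ← trans (sym e) e′

  last-reverse : ∀ (w : Word) {a} → head w ≡ just a → last (reverse w) ≡ just a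
  last-reverse (x ∷ w) refl = trans (cong last (unfold-reverse x w)) (last-∷ʳ (reverse w) x)

  head-reverse : ∀ (w : Word) {b} → last w ≡ just b → head (reverse w) ≡ just b
  head-reverse w e with v , refl ← last≡just w e = cong head (reverse-++ v _)

  #-reverse : ∀ a b z h → #⟨ a , b ⟩ z h ≡ #⟨ b , a ⟩ z h
  #-reverse a b z h = count-bij (𝕊⟨ a , b ⟩? (z + h) h) (𝕊⟨ b , a ⟩? (z + h) h) reverse id
    reverse-injective id (λ _ → proj₁ ∘ proj₁ ∘ proj₁) (λ _ → proj₁ ∘ proj₁ ∘ proj₁)
    (λ v p → reverse v , reversed v p , refl)
    (λ w q → reverse w , reversed w q , reverse-involutive w)
    where
    reversed : ∀ {a b} w → 𝕊⟨ a , b ⟩ (z + h) h w → 𝕊⟨ b , a ⟩ (z + h) h (reverse w)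
    reversed w (((len , ht , bal) , hd) , lst) =
      ((trans (length-reverse w) len , trans (∣∣₁-reverse w) ht , reverse-balanced bal)
      , head-reverse w lst) , last-reverse w hd

  complement-injective : ∀ {v w} → complement v ≡ complement w → v ≡ w
  complement-injective {v} {w} e =
    trans (sym (complement-involutive v)) (trans (cong complement e) (complement-involutive w))

  complement-𝕊 : ∀ z h {w} → 𝕊 (z + h) h w → 𝕊 (h + z) z (complement w)
  complement-𝕊 z h {w} (len , ht , bal) =
    trans (length-map opposite w) (trans len (+-comm z h)) ,
    +-cancelʳ-≡ h _ _ (trans (cong (_ +_) (sym ht)) (trans (∣∣₁-complement w) len)) ,
    complement-balanced bal

  #-complement : ∀ z h → #⟨∙,∙⟩ z h ≡ #⟨∙,∙⟩ h z
  #-complement z h = count-bij (𝕊? (z + h) h) (𝕊? (h + z) z) complement id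
    complement-injective id (λ _ → proj₁) (λ _ → proj₁)
    (λ v p → complement v , complement-𝕊 z h p , refl)
    (λ w q → complement w , complement-𝕊 h z q , complement-involutive w)

  #⟨⟩-complement : ∀ a b z h → #⟨ a , b ⟩ z h ≡ #⟨ opposite a , opposite b ⟩ h z
  #⟨⟩-complement a b z h = count-bij (𝕊⟨ a , b ⟩? (z + h) h) (𝕊⟨ opposite a , opposite b ⟩? (h + z) z) complement id
    complement-injective id (λ _ → proj₁ ∘ proj₁ ∘ proj₁) (λ _ → proj₁ ∘ proj₁ ∘ proj₁)
    (λ v p → complement v , ends z h p , refl)
    (λ w q → complement w ,
      subst₂ (λ a b → 𝕊⟨ a , b ⟩ (z + h) h (complement w)) (opposite-involutive a) (opposite-involutive b)
             (ends h z q) ,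
      complement-involutive w)
    where
    ends : ∀ {a b} z h {w} → 𝕊⟨ a , b ⟩ (z + h) h w → 𝕊⟨ opposite a , opposite b ⟩ (h + z) z (complement w)
    ends z h {w} ((p , hd) , lst) =
      (complement-𝕊 z h p , trans (head-map w) (cong (Maybe.map opposite) hd)) ,
      trans (last-map opposite w) (cong (Maybe.map opposite) lst)

  -- Counting identities obtained from `Ψ`.

  head-Ψ : ∀ u → head (Ψ u) ≡ just 0F
  head-Ψ u = cong head (proj₂ (Ψ-∷ u))

  last-∷ : ∀ a {b} (w : Word) → last w ≡ just b → last (a ∷ w) ≡ just b
  last-∷ a (_ ∷ _) e = e

  last-Ψ : ∀ u → last (Ψ u) ≡ just 0F
  last-Ψ []       = refl
  last-Ψ (0F ∷ u) = last-∷ 0F (Ψ u) (last-Ψ u)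
  last-Ψ (1F ∷ u) = last-∷ 0F (1F ∷ Ψ u) (last-∷ 1F (Ψ u) (last-Ψ u))

  Ψ-𝕊⁺ : ∀ {L h u} → 𝕊 L h u → 𝕊 (suc (L + h)) h (Ψ u)
  Ψ-𝕊⁺ {u = u} (len , ht , bal) =
    trans (length-Ψ u) (cong suc (cong₂ _+_ len ht)) , trans (∣Ψ∣₁ u) ht , Ψ-balanced⁺ bal

  Ψ-𝕊⁻ : ∀ {L h u} → 𝕊 (suc (L + h)) h (Ψ u) → 𝕊 L h u
  Ψ-𝕊⁻ {L} {h} {u} (len , ht , bal) = +-cancelʳ-≡ h _ _ (trans (cong (_ +_) (sym ht′))
    (suc-injective (trans (sym (length-Ψ u)) len))) , ht′ , Ψ-balanced⁻ bal
    where
    ht′ : ∣ u ∣₁ ≡ h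
    ht′ = trans (sym (∣Ψ∣₁ u)) ht

  Ψ-surjective′ : ∀ w → head w ≡ just 0F → last w ≡ just 0F → No11 w → ∃[ u ] Ψ u ≡ w
  Ψ-surjective′ w hd lst no11 with v , refl ← last≡just w lst = Ψ-surjective v hd no11

  -- `Ψ` adds one 0 for each 1 and a closing 0, so z becomes z + h + 1. Conversely the length z + 2h
  -- + 1 exceeds 2h, so 11 is excluded and the word is a `Ψ`-image.
  #00 : ∀ z h → #⟨ 0F , 0F ⟩ (suc (z + h)) h ≡ #⟨∙,∙⟩ z h
  #00 z h = sym (count-bij (𝕊? (z + h) h) (𝕊⟨ 0F , 0F ⟩? (suc (z + h) + h) h) Ψ id Ψ-injective id
    (λ _ → proj₁) (λ _ → proj₁ ∘ proj₁ ∘ proj₁)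
    (λ u p → Ψ u , ((Ψ-𝕊⁺ p , head-Ψ u) , last-Ψ u) , refl) from)
    where
    from : ∀ w → 𝕊⟨ 0F , 0F ⟩ (suc (z + h) + h) h w → ∃[ u ] 𝕊 (z + h) h u × Ψ u ≡ w
    from w ((p@(len , ht , bal) , hd) , lst) =
      let no11 = balanced-no11 w hd lst bal
                   (subst₂ (λ l k → 2 * k < l + 0 + 0) (sym len) (sym ht)
                     (≤-trans (m≤m+n _ z) (≤-reflexive (lem z h))))
          u , e = Ψ-surjective′ w hd lst no11
      in u , Ψ-𝕊⁻ (subst (𝕊 _ h) (sym e) p) , e
      where
      lem : ∀ z h → suc (2 * h) + z ≡ suc (z + h) + h + 0 + 0
      lem = solve-∀

  no11-0∷ : ∀ {w} → No11 w → No11 (0F ∷ w)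
  no11-0∷ no11 (here (() ∷ _))
  no11-0∷ no11 (there i) = no11 i

  reverse-reverse-∷ʳ : ∀ (w : Word) a → reverse (a ∷ reverse w) ≡ w ∷ʳ a
  reverse-reverse-∷ʳ w a = trans (unfold-reverse a (reverse w)) (cong (_∷ʳ a) (reverse-involutive w))

  no11-∷ʳ0 : ∀ {w} → No11 w → No11 (w ∷ʳ 0F)
  no11-∷ʳ0 {w} no11 = subst No11 (reverse-reverse-∷ʳ w 0F) (no11-reverse (no11-0∷ (no11-reverse no11)))

  -- The mirror image of `0∷-balanced`, obtained by reversing before and after.
  ∷ʳ0-balanced : ∀ {w} → last w ≡ just 1F → No11 w → Balanced w → Balanced (w ∷ʳ 0F)
  ∷ʳ0-balanced {w} lst no11 bal with v , e ← head≡just (reverse w) (head-reverse w lst) =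
    subst Balanced (trans (cong (reverse ∘ (0F ∷_)) (sym e)) (reverse-reverse-∷ʳ w 0F))
      (reverse-balanced (0∷-balanced (subst No11 e (no11-reverse no11)) (subst Balanced e (reverse-balanced bal))))

  ⊑-refl : ∀ {w} → w ⊑ w
  ⊑-refl = fromPointwise (Pointwise.refl refl)

  head-Ψ⁻ : ∀ u {w} → Ψ u ≡ 0F ∷ w → head w ≡ just 1F → head u ≡ just 1F
  head-Ψ⁻ (1F ∷ u) _ _ = refl
  head-Ψ⁻ []       refl ()
  head-Ψ⁻ (0F ∷ u) refl hd with () ← trans (sym (head-Ψ u)) hd

  Ψ-∷ʳ0 : ∀ u → Ψ (u ∷ʳ 0F) ≡ Ψ u ∷ʳ 0F
  Ψ-∷ʳ0 []       = refl
  Ψ-∷ʳ0 (0F ∷ u) = cong (0F ∷_) (Ψ-∷ʳ0 u)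
  Ψ-∷ʳ0 (1F ∷ u) = cong (λ w → 0F ∷ 1F ∷ w) (Ψ-∷ʳ0 u)

  Ψ-∷ʳ1 : ∀ u → Ψ (u ∷ʳ 1F) ≡ Ψ u ∷ʳ 1F ∷ʳ 0F
  Ψ-∷ʳ1 []       = refl
  Ψ-∷ʳ1 (0F ∷ u) = cong (0F ∷_) (Ψ-∷ʳ1 u)
  Ψ-∷ʳ1 (1F ∷ u) = cong (λ w → 0F ∷ 1F ∷ w) (Ψ-∷ʳ1 u)

  -- If u starts with 1, then `Ψ u` starts with 01, and dropping its first 0 gives a word from 1 to
  -- 0, whatever the last letter of u. `0∷-balanced` allows that 0 to be put back.
  #10 : ∀ z h → #⟨ 1F , 0F ⟩ (z + h) h ≡ #⟨ 1F ,∙⟩ z h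
  #10 z h = sym (count-bij (𝕊⟨ 1F ∙⟩? (z + h) h) (𝕊⟨ 1F , 0F ⟩? (z + h + h) h) Ψ (0F ∷_) Ψ-injective ∷-injectiveʳ
    (λ _ → proj₁ ∘ proj₁) (λ _ → proj₁ ∘ proj₁ ∘ proj₁) to from)
    where
    to : ∀ u → 𝕊⟨ 1F ∙⟩ (z + h) h u → ∃[ w ] 𝕊⟨ 1F , 0F ⟩ (z + h + h) h w × Ψ u ≡ 0F ∷ w
    to (1F ∷ u) (p , refl) with len , ht , bal ← Ψ-𝕊⁺ p =
      1F ∷ Ψ u , (((suc-injective len , ht , balanced-⊑ (there ⊑-refl) bal) , refl)
        , last-∷ 1F (Ψ u) (last-Ψ u)) , refl
    from : ∀ w → 𝕊⟨ 1F , 0F ⟩ (z + h + h) h w → ∃[ u ] 𝕊⟨ 1F ∙⟩ (z + h) h u × Ψ u ≡ 0F ∷ w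
    from (1F ∷ w) (((len , ht , bal) , refl) , lst) =
      let no11 = balanced-no11 (1F ∷ w) refl lst bal
                   (subst₂ (λ l k → 2 * k < l + 1 + 0) (sym len) (sym ht)
                     (≤-trans (m≤m+n _ z) (≤-reflexive (lem z h))))
          u , e = Ψ-surjective′ (0F ∷ 1F ∷ w) refl lst (no11-0∷ no11)
      in u , (Ψ-𝕊⁻ (subst (𝕊 _ h) (sym e) (cong suc len , ht , 0∷-balanced no11 bal))
             , head-Ψ⁻ u e refl) , e
      where
      lem : ∀ z h → suc (2 * h) + z ≡ z + h + h + 1 + 0
      lem = solve-∀

  -- If u starts and ends with 1, then `Ψ u` has the form 0w0 with w from 1 to 1. The number of 0's
  -- in w is z + (h + 1) + 1 - 2 = z + h.
  #11 : ∀ z h → #⟨ 1F , 1F ⟩ (z + h) (suc h) ≡ #⟨ 1F , 1F ⟩ z (suc h)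
  #11 z h = sym (count-bij (𝕊⟨ 1F , 1F ⟩? (z + suc h) (suc h)) (𝕊⟨ 1F , 1F ⟩? (z + h + suc h) (suc h))
    Ψ (λ w → 0F ∷ w ∷ʳ 0F) Ψ-injective (λ {v} {w} e → ∷ʳ-injectiveˡ v w (∷-injectiveʳ e))
    (λ _ → proj₁ ∘ proj₁ ∘ proj₁) (λ _ → proj₁ ∘ proj₁ ∘ proj₁) to from)
    where
    len-eq : ∀ z h → z + suc h + suc h ≡ suc (z + h + suc h)
    len-eq = solve-∀

    Ψu≡ : ∀ {v x} → Ψ v ≡ 0F ∷ x → Ψ (v ∷ʳ 1F) ≡ 0F ∷ x ∷ʳ 1F ∷ʳ 0F
    Ψu≡ {v} e = trans (Ψ-∷ʳ1 v) (cong (λ w → w ∷ʳ 1F ∷ʳ 0F) e)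
    starts : ∀ u x → head u ≡ just 1F → Ψ u ≡ 0F ∷ x ∷ʳ 1F ∷ʳ 0F → head (x ∷ʳ 1F) ≡ just 1F
    starts (1F ∷ u) []      _ _ = refl
    starts (1F ∷ u) (_ ∷ x) _ e = sym (cong head (∷-injectiveʳ e))

    to : ∀ u → 𝕊⟨ 1F , 1F ⟩ (z + suc h) (suc h) u →
         ∃[ w ] 𝕊⟨ 1F , 1F ⟩ (z + h + suc h) (suc h) w × Ψ u ≡ 0F ∷ w ∷ʳ 0F
    -- With u = v1 and `Ψ v` = 0x the image `Ψ u` is 0x10, so x1 is what remains without the outer
    -- 0's.
    to u ((p , hd) , lst)
      with v , refl ← last≡just u lst
      with x , e ← Ψ-∷ v
      with len , ht , bal ← subst (𝕊 _ (suc h)) (Ψu≡ e) (Ψ-𝕊⁺ p) =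
      x ∷ʳ 1F ,
      (((suc-injective (suc-injective (trans (sym (cong suc (length-∷ʳ (x ∷ʳ 1F)))) (trans len (cong suc (len-eq z h))))) ,
         trans (sym (∣∣₁-∷ʳ0 (x ∷ʳ 1F))) ht ,
         balanced-⊑ (there (⊑-refl ⁱ++ _)) bal) ,
        starts (v ∷ʳ 1F) x hd (Ψu≡ e)) , last-∷ʳ x 1F) ,
      Ψu≡ e

    from : ∀ w → 𝕊⟨ 1F , 1F ⟩ (z + h + suc h) (suc h) w →
           ∃[ u ] 𝕊⟨ 1F , 1F ⟩ (z + suc h) (suc h) u × Ψ u ≡ 0F ∷ w ∷ʳ 0F
    from (1F ∷ w) (((len , ht , bal) , refl) , lst) =
      let no11 = balanced-no11 (1F ∷ w) refl lst bal
                   (subst₂ (λ l k → 2 * k < l + 1 + 1) (sym len) (sym ht)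
                     (≤-trans (m≤m+n _ z) (≤-reflexive (lem z h))))
          u , e = Ψ-surjective′ (0F ∷ 1F ∷ w ∷ʳ 0F) refl (last-∷ʳ (0F ∷ 1F ∷ w) 0F) (no11-∷ʳ0 (no11-0∷ no11))
          hd = head-Ψ⁻ u e refl
      in u ,
         ((Ψ-𝕊⁻ (subst (𝕊 _ (suc h)) (sym e)
             ( trans (cong suc (length-∷ʳ (1F ∷ w))) (cong suc (trans (cong suc len) (sym (len-eq z h))))
             , trans (∣∣₁-∷ʳ0 (1F ∷ w)) ht
             , ∷ʳ0-balanced lst (no11-0∷ no11) (0∷-balanced no11 bal)))
          , hd) , ends u hd e) , e
      where
      lem : ∀ z h → suc (2 * suc h) + z ≡ z + h + suc h + 1 + 1
      lem = solve-∀
      ends : ∀ u → head u ≡ just 1F → Ψ u ≡ 0F ∷ 1F ∷ w ∷ʳ 0F → last u ≡ just 1F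
      ends (x ∷ u) hd e with last-letter x u
      ... | inj₂ l = l
      -- If u ended with 0, then `Ψ u` would end with 00, whereas the letter before its final 0 is
      -- 1.
      ... | inj₁ l with v , e′ ← last≡just (x ∷ u) l
        with () ← trans (sym lst) (trans (sym (cong last (∷ʳ-injectiveˡ (Ψ v) (0F ∷ 1F ∷ w)
                    (trans (sym (Ψ-∷ʳ0 v)) (trans (cong Ψ (sym e′)) e))))) (last-Ψ v))

  -- Vanishing counts, and the heights 0 and 1.

  last0⇒∣∣₁<length : ∀ w → last w ≡ just 0F → ∣ w ∣₁ < length w
  last0⇒∣∣₁<length (0F ∷ [])    _ = s≤s z≤n
  last0⇒∣∣₁<length (0F ∷ y ∷ w) e = m≤n⇒m≤1+n (last0⇒∣∣₁<length (y ∷ w) e)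
  last0⇒∣∣₁<length (1F ∷ y ∷ w) e = s≤s (last0⇒∣∣₁<length (y ∷ w) e)

  #00-zero : ∀ h → #⟨ 0F , 0F ⟩ 0 h ≡ 0
  #00-zero h = count-empty (𝕊⟨ 0F , 0F ⟩? h h)
    (λ w (((len , ht , _) , _) , lst) → <-irrefl (trans ht (sym len)) (last0⇒∣∣₁<length w lst)) h

  -- The only 0 would have to be both the first and the last letter of a word with at least two
  -- letters.
  #00-one : ∀ h → #⟨ 0F , 0F ⟩ 1 (suc h) ≡ 0
  #00-one h = count-empty (𝕊⟨ 0F , 0F ⟩? (2 + h) (suc h)) none (2 + h)
    where
    none : ∀ w → ¬ 𝕊⟨ 0F , 0F ⟩ (2 + h) (suc h) w
    none (0F ∷ y ∷ w) (((len , ht , _) , _) , lst) =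
      <-irrefl (trans ht (sym (suc-injective len))) (last0⇒∣∣₁<length (y ∷ w) lst)

  #1∙-height-zero : ∀ z → #⟨ 1F ,∙⟩ z 0 ≡ 0
  #1∙-height-zero z = count-empty (𝕊⟨ 1F ∙⟩? (z + 0) 0) (λ { (1F ∷ w) ((_ , () , _) , _) }) (z + 0)

  #11-zero : ∀ h → #⟨ 1F , 1F ⟩ (suc h) 1 ≡ 0
  #11-zero h = trans (#⟨⟩-complement 1F 1F (suc h) 1) (#00-one h)

  #-ends : ∀ z h → 0 < z + h →
    #⟨∙,∙⟩ z h ≡ #⟨ 0F , 0F ⟩ z h + 2 * #⟨ 1F , 0F ⟩ z h + #⟨ 1F , 1F ⟩ z h
  #-ends z h 0<L = begin
    #⟨∙,∙⟩ z h                        ≡⟨ #-head z h 0<L ⟩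
    #⟨ 0F ,∙⟩ z h + #⟨ 1F ,∙⟩ z h     ≡⟨ cong₂ _+_ (#-last 0F z h) (#-last 1F z h) ⟩
    a + #⟨ 0F , 1F ⟩ z h + (b + c)    ≡⟨ cong (λ x → a + x + (b + c)) (#-reverse 0F 1F z h) ⟩
    a + b + (b + c)                   ≡⟨ lem a b c ⟩
    a + 2 * b + c                     ∎
    where
    open ≡-Reasoning
    a = #⟨ 0F , 0F ⟩ z h
    b = #⟨ 1F , 0F ⟩ z h
    c = #⟨ 1F , 1F ⟩ z h
    lem : ∀ a b c → a + b + (b + c) ≡ a + 2 * b + c
    lem = solve-∀

  #10-step : ∀ z h → #⟨ 1F , 0F ⟩ (z + h) h ≡ #⟨ 1F , 0F ⟩ z h + #⟨ 1F , 1F ⟩ z h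
  #10-step z h = trans (#10 z h) (#-last 1F z h)

  #-height-zero : ∀ z → #⟨∙,∙⟩ z 0 ≡ 1
  #-height-zero zero    = refl
  #-height-zero (suc z) = begin
    #⟨∙,∙⟩ (suc z) 0 ≡⟨ #-ends (suc z) 0 (s≤s z≤n) ⟩
    #⟨ 0F , 0F ⟩ (suc z) 0 + 2 * #⟨ 1F , 0F ⟩ (suc z) 0 + #⟨ 1F , 1F ⟩ (suc z) 0
      ≡⟨ cong₂ (λ b c → #⟨ 0F , 0F ⟩ (suc z) 0 + 2 * b + c)
           (m+n≡0⇒m≡0 (#⟨ 1F , 0F ⟩ (suc z) 0) none) (m+n≡0⇒n≡0 (#⟨ 1F , 0F ⟩ (suc z) 0) none) ⟩
    #⟨ 0F , 0F ⟩ (suc z) 0 + 0 + 0   ≡⟨ trans (+-identityʳ _) (+-identityʳ _) ⟩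
    #⟨ 0F , 0F ⟩ (suc z) 0           ≡⟨ cong (λ z → #⟨ 0F , 0F ⟩ (suc z) 0) (+-identityʳ z) ⟨
    #⟨ 0F , 0F ⟩ (suc (z + 0)) 0     ≡⟨ #00 z 0 ⟩
    #⟨∙,∙⟩ z 0                       ≡⟨ #-height-zero z ⟩
    1                                ∎
    where
    open ≡-Reasoning
    none : #⟨ 1F , 0F ⟩ (suc z) 0 + #⟨ 1F , 1F ⟩ (suc z) 0 ≡ 0
    none = trans (sym (#-last 1F (suc z) 0)) (#1∙-height-zero (suc z))

  #10-height-one : ∀ z → #⟨ 1F , 0F ⟩ (suc z) 1 ≡ 1
  #10-height-one zero    = refl
  #10-height-one (suc z) = begin
    #⟨ 1F , 0F ⟩ (suc (suc z)) 1     ≡⟨ cong (λ z → #⟨ 1F , 0F ⟩ z 1) (+-comm 1 (suc z)) ⟩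
    #⟨ 1F , 0F ⟩ (suc z + 1) 1       ≡⟨ #10-step (suc z) 1 ⟩
    #⟨ 1F , 0F ⟩ (suc z) 1 + #⟨ 1F , 1F ⟩ (suc z) 1 ≡⟨ cong₂ _+_ (#10-height-one z) (#11-zero z) ⟩
    1                                ∎
    where open ≡-Reasoning

  -- With a single 1, `#00` goes back by two 0's, so the induction has step two; the two words with
  -- their 1 at an end make up the difference.
  #-height-one : ∀ z → #⟨∙,∙⟩ z 1 ≡ suc z
  #-height-one 0             = refl
  #-height-one 1             = refl
  #-height-one (suc (suc z)) = begin
    #⟨∙,∙⟩ (suc (suc z)) 1 ≡⟨ #-ends (suc (suc z)) 1 (s≤s z≤n) ⟩
    #⟨ 0F , 0F ⟩ (suc (suc z)) 1 + 2 * #⟨ 1F , 0F ⟩ (suc (suc z)) 1 + #⟨ 1F , 1F ⟩ (suc (suc z)) 1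
      ≡⟨ cong₂ _+_ (cong₂ (λ a b → a + 2 * b) #00≡ (#10-height-one (suc z))) (#11-zero (suc z)) ⟩
    suc z + 2 + 0           ≡⟨ +-identityʳ _ ⟩
    suc z + 2               ≡⟨ +-comm (suc z) 2 ⟩
    suc (suc (suc z))       ∎
    where
    open ≡-Reasoning
    #00≡ : #⟨ 0F , 0F ⟩ (suc (suc z)) 1 ≡ suc z
    #00≡ = trans (cong (λ y → #⟨ 0F , 0F ⟩ (suc y) 1) (+-comm 1 z)) (trans (#00 z 1) (#-height-one z))

  -- The function `s` in terms of the counts, and its recurrence.

  #11-complement : ∀ z h → #⟨ 1F , 1F ⟩ z (suc (h + z)) ≡ #⟨∙,∙⟩ h z
  #11-complement z h = trans (#⟨⟩-complement 1F 1F z (suc (h + z))) (#00 h z)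

  #11-periodic : ∀ z k h → #⟨ 1F , 1F ⟩ (z + k * h) (suc h) ≡ #⟨ 1F , 1F ⟩ z (suc h)
  #11-periodic z zero    h = cong (λ z → #⟨ 1F , 1F ⟩ z (suc h)) (+-identityʳ z)
  #11-periodic z (suc k) h = begin
    #⟨ 1F , 1F ⟩ (z + (h + k * h)) (suc h) ≡⟨ cong (λ z → #⟨ 1F , 1F ⟩ z (suc h)) (lem z h (k * h)) ⟩
    #⟨ 1F , 1F ⟩ (z + k * h + h) (suc h)   ≡⟨ #11 (z + k * h) h ⟩
    #⟨ 1F , 1F ⟩ (z + k * h) (suc h)       ≡⟨ #11-periodic z k h ⟩
    #⟨ 1F , 1F ⟩ z (suc h)                 ∎
    where
    open ≡-Reasoning
    lem : ∀ z h k → z + (h + k) ≡ z + k + h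
    lem = solve-∀

  -- Periodicity replaces z by its remainder modulo n + 1, just as `s` does with its second
  -- argument. For such a remainder, complementation gives the balanced words of length n + 1 with
  -- that height.
  #11-s : ∀ z n → #⟨ 1F , 1F ⟩ z (suc (suc n)) ≡ s (ℤ.+ suc n) (ℤ.+ z)
  #11-s z n = begin
    #⟨ 1F , 1F ⟩ z (suc h)               ≡⟨ cong (λ z → #⟨ 1F , 1F ⟩ z (suc h)) (m≡m%n+[m/n]*n z h) ⟩
    #⟨ 1F , 1F ⟩ (r + z / h * h) (suc h) ≡⟨ #11-periodic r (z / h) h ⟩
    #⟨ 1F , 1F ⟩ r (suc h)               ≡⟨ cong (λ h → #⟨ 1F , 1F ⟩ r (suc h)) split ⟨
    #⟨ 1F , 1F ⟩ r (suc (h ∸ r + r))     ≡⟨ #11-complement r (h ∸ r) ⟩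
    #𝕊 (h ∸ r + r) r                     ≡⟨ cong (λ h → #𝕊 h r) split ⟩
    #𝕊 h r                               ∎
    where
    open ≡-Reasoning
    h = suc n
    r = z % h
    split : h ∸ r + r ≡ h
    split = m∸n+n≡m (<⇒≤ (m%n<n z h))

  -- Reduction modulo the length changes the height only for z = 0, where it becomes 0;
  -- complementation then exchanges the words of 0's only and of 1's only.
  s-# : ∀ z h → s (ℤ.+ (z + suc h)) (ℤ.+ suc h) ≡ #⟨∙,∙⟩ z (suc h)
  s-# zero    h = begin
    #𝕊 (suc h) (suc h % suc h) ≡⟨ cong (#𝕊 (suc h)) (n%n≡0 (suc h)) ⟩
    #𝕊 (suc h) 0               ≡⟨ cong (λ h → #𝕊 h 0) (+-identityʳ (suc h)) ⟨
    #⟨∙,∙⟩ (suc h) 0           ≡⟨ #-complement (suc h) 0 ⟩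
    #⟨∙,∙⟩ 0 (suc h)           ∎
    where open ≡-Reasoning
  s-# (suc z) h = cong (#𝕊 (suc (z + suc h))) (m<n⇒m%n≡m (s≤s (m≤n+m (suc h) z)))

  -- Three ranges of y: at 0 both sides vanish; below the height h + 1, where `s` reduces its second
  -- argument, complementation leads to `#11-s`; from h + 1 on, `#00` applies directly.
  s-#00 : ∀ y h → s (ℤ.+ y) (ℤ.+ suc h) ≡ #⟨ 0F , 0F ⟩ (suc y) (suc h)
  s-#00 zero    h = sym (#00-one h)
  s-#00 (suc n) h with n <? h
  ... | yes n<h = sym (trans (#⟨⟩-complement 0F 0F (suc (suc n)) (suc h)) (#11-s (suc h) n))
  ... | no  n≮h with z , refl ← m≤n⇒∃[o]m+o≡n (≮⇒≥ n≮h) = begin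
    s (ℤ.+ suc (h + z)) (ℤ.+ suc h)           ≡⟨ cong (λ y → s (ℤ.+ y) (ℤ.+ suc h)) (+-comm (suc h) z) ⟩
    s (ℤ.+ (z + suc h)) (ℤ.+ suc h)           ≡⟨ s-# z h ⟩
    #⟨∙,∙⟩ z (suc h)                          ≡⟨ #00 z (suc h) ⟨
    #⟨ 0F , 0F ⟩ (suc (z + suc h)) (suc h)    ≡⟨ cong (λ y → #⟨ 0F , 0F ⟩ (suc y) (suc h)) (+-comm z (suc h)) ⟩
    #⟨ 0F , 0F ⟩ (suc (suc (h + z))) (suc h)  ∎
    where open ≡-Reasoning

  s-periodic : ∀ n y → s (ℤ.+ suc n) (ℤ.+ (y + suc n)) ≡ s (ℤ.+ suc n) (ℤ.+ y)
  s-periodic n y = cong (#𝕊 (suc n)) ([m+n]%n≡m%n y (suc n))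

  -- By s-#00, #⟨ 0F , 0F ⟩ y h is s (y - 1) h.
  s-recurrence : ∀ y n → let h = suc (suc n) in
    s (ℤ.+ (y + h + h)) (ℤ.+ h) + #⟨ 0F , 0F ⟩ y h
    ≡ s (ℤ.+ (y + h)) (ℤ.+ h) + s (ℤ.+ (y + suc n)) (ℤ.+ h)
      + s (ℤ.+ suc n) (ℤ.+ suc y) + s (ℤ.+ suc n) (ℤ.+ y)
  s-recurrence y n = begin
    s (ℤ.+ (y + h + h)) (ℤ.+ h) + e₀₀ y
      ≡⟨ cong (_+ e₀₀ y) (trans (s-# (y + h) (suc n)) (#-ends (y + h) h (≤-trans (s≤s z≤n) (m≤n+m h (y + h))))) ⟩
    e₀₀ (y + h) + 2 * e₁₀ (y + h) + e₁₁ (y + h) + e₀₀ y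
      ≡⟨ cong₂ (λ b c → e₀₀ (y + h) + 2 * b + c + e₀₀ y) (#10-step y h) e₁₁≡ ⟩
    e₀₀ (y + h) + 2 * (e₁₀ y + e₁₁ y) + e₁₁ (suc y) + e₀₀ y
      -- Of the two copies of `e₁₁ y`, one completes the total count T(y,h) and the other survives
      -- as s(h-1,y).
      ≡⟨ lem (e₀₀ (y + h)) (e₁₀ y) (e₁₁ y) (e₁₁ (suc y)) (e₀₀ y) ⟩
    e₀₀ y + 2 * e₁₀ y + e₁₁ y + e₀₀ (y + h) + e₁₁ (suc y) + e₁₁ y
      ≡⟨ cong₂ _+_ (cong₂ _+_ (cong₂ _+_
           (trans (s-# y (suc n)) (#-ends y h (≤-trans (s≤s z≤n) (m≤n+m h y))))
           (trans (s-#00 (y + suc n) (suc n)) (cong e₀₀ (sym (+-suc y (suc n))))))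
           (sym (#11-s (suc y) n))) (sym (#11-s y n)) ⟨
    s (ℤ.+ (y + h)) (ℤ.+ h) + s (ℤ.+ (y + suc n)) (ℤ.+ h)
      + s (ℤ.+ suc n) (ℤ.+ suc y) + s (ℤ.+ suc n) (ℤ.+ y) ∎
    where
    open ≡-Reasoning
    h = suc (suc n)
    e₀₀ e₁₀ e₁₁ : ℕ → ℕ
    e₀₀ y = #⟨ 0F , 0F ⟩ y h
    e₁₀ y = #⟨ 1F , 0F ⟩ y h
    e₁₁ y = #⟨ 1F , 1F ⟩ y h
    e₁₁≡ : e₁₁ (y + h) ≡ e₁₁ (suc y)
    e₁₁≡ = trans (cong e₁₁ (+-suc y (suc n))) (#11 (suc y) (suc n))
    lem : ∀ a b c t d → a + 2 * (b + c) + t + d ≡ d + 2 * b + c + a + t + c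
    lem = solve-∀

-- The commutative ring of integer power series.

module PowerSeriesRing where

  open import Defs using (PowerSeries; const; powerSeriesRawRing; _≈_; _+_; _*_; -_; 0#; 1#)
  open import Algebra.Bundles using (CommutativeRing)
  open import Algebra.Bundles.Raw using (RawRing)
  open import Algebra.Structures using (IsAbelianGroup; IsCommutativeRing)
  import Algebra.Consequences.Setoid as Consequences
  open import Algebra.Solver.Ring.AlmostCommutativeRing using (fromCommutativeRing; _-Raw-AlmostCommutative⟶_)
  open import Data.Integer.Base as ℤ using (ℤ; +_)
  import Data.Integer.Properties as ℤ
  open import Data.Integer.Tactic.RingSolver using (solve-∀)
  open import Data.Nat.Base as ℕ using (ℕ; zero; suc)
  open import Function.Base using (_∘_)
  open import Level using (0ℓ)
  open import Relation.Binary.Bundles using (Setoid)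
  open import Relation.Binary.PropositionalEquality as ≡ using (_≡_; refl; sym; trans; cong; cong₂; _→-setoid_)

  setoid : Setoid 0ℓ 0ℓ
  setoid = ℕ →-setoid ℤ

  tail : PowerSeries → PowerSeries
  tail f = f ∘ suc

  -- Definitionally the tail of every `const` series and its own tail.
  0ˢ : PowerSeries
  0ˢ _ = + 0

  0#≈0ˢ : 0# ≈ 0ˢ
  0#≈0ˢ zero    = refl
  0#≈0ˢ (suc _) = refl

  -- The recursions (f * g) 0 = f 0 * g 0 + 0 and
  -- (f * g) (n + 1) = f 0 * g (n + 1) + (tail f * g) n hold definitionally.

  *-cong : ∀ {f f′ g g′} → f ≈ f′ → g ≈ g′ → f * g ≈ f′ * g′
  *-cong p q zero    = cong (λ z → z ℤ.+ + 0) (cong₂ ℤ._*_ (p 0) (q 0))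
  *-cong p q (suc n) = cong₂ ℤ._+_ (cong₂ ℤ._*_ (p 0) (q (suc n))) (*-cong (p ∘ suc) q n)

  *-distribʳ-+ : ∀ k f g → (f + g) * k ≈ f * k + g * k
  *-distribʳ-+ k f g zero    = lem (f 0) (g 0) (k 0)
    where
    lem : ∀ a b c → (a ℤ.+ b) ℤ.* c ℤ.+ + 0 ≡ (a ℤ.* c ℤ.+ + 0) ℤ.+ (b ℤ.* c ℤ.+ + 0)
    lem = solve-∀
  *-distribʳ-+ k f g (suc n) = trans (cong (λ z → (f + g) 0 ℤ.* k (suc n) ℤ.+ z) (*-distribʳ-+ k (tail f) (tail g) n))
    (lem (f 0) (g 0) (k (suc n)) ((tail f * k) n) ((tail g * k) n))
    where
    lem : ∀ a b c d e → (a ℤ.+ b) ℤ.* c ℤ.+ (d ℤ.+ e) ≡ (a ℤ.* c ℤ.+ d) ℤ.+ (b ℤ.* c ℤ.+ e)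
    lem = solve-∀

  infixr 7 _·_
  _·_ : ℤ → PowerSeries → PowerSeries
  (c · f) n = c ℤ.* f n

  ·-*-assoc : ∀ c f g → (c · f) * g ≈ c · (f * g)
  ·-*-assoc c f g zero    = lem c (f 0) (g 0)
    where
    lem : ∀ a b c → a ℤ.* b ℤ.* c ℤ.+ + 0 ≡ a ℤ.* (b ℤ.* c ℤ.+ + 0)
    lem = solve-∀
  ·-*-assoc c f g (suc n) = trans (cong (λ z → (c · f) 0 ℤ.* g (suc n) ℤ.+ z) (·-*-assoc c (tail f) g n))
    (lem c (f 0) (g (suc n)) ((tail f * g) n))
    where
    lem : ∀ a b c d → a ℤ.* b ℤ.* c ℤ.+ a ℤ.* d ≡ a ℤ.* (b ℤ.* c ℤ.+ d)
    lem = solve-∀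

  *-assoc : ∀ f g k → (f * g) * k ≈ f * (g * k)
  *-assoc f g k zero    = lem (f 0) (g 0) (k 0)
    where
    lem : ∀ a b c → (a ℤ.* b ℤ.+ + 0) ℤ.* c ℤ.+ + 0 ≡ a ℤ.* (b ℤ.* c ℤ.+ + 0) ℤ.+ + 0
    lem = solve-∀
  *-assoc f g k (suc n) = begin
    (f 0 ℤ.* g 0 ℤ.+ + 0) ℤ.* k (suc n) ℤ.+ ((f 0 · tail g + tail f * g) * k) n
      ≡⟨ cong (λ z → (f 0 ℤ.* g 0 ℤ.+ + 0) ℤ.* k (suc n) ℤ.+ z) (*-distribʳ-+ k (f 0 · tail g) (tail f * g) n) ⟩
    (f 0 ℤ.* g 0 ℤ.+ + 0) ℤ.* k (suc n) ℤ.+ (((f 0 · tail g) * k) n ℤ.+ ((tail f * g) * k) n)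
      ≡⟨ cong (λ z → (f 0 ℤ.* g 0 ℤ.+ + 0) ℤ.* k (suc n) ℤ.+ z) (cong₂ ℤ._+_ (·-*-assoc (f 0) (tail g) k n) (*-assoc (tail f) g k n)) ⟩
    (f 0 ℤ.* g 0 ℤ.+ + 0) ℤ.* k (suc n) ℤ.+ (f 0 ℤ.* (tail g * k) n ℤ.+ (tail f * (g * k)) n)
      ≡⟨ lem (f 0) (g 0) (k (suc n)) ((tail g * k) n) ((tail f * (g * k)) n) ⟩
    f 0 ℤ.* (g 0 ℤ.* k (suc n) ℤ.+ (tail g * k) n) ℤ.+ (tail f * (g * k)) n ∎
    where
    open ≡.≡-Reasoning
    lem : ∀ a b c d e → (a ℤ.* b ℤ.+ + 0) ℤ.* c ℤ.+ (a ℤ.* d ℤ.+ e) ≡ a ℤ.* (b ℤ.* c ℤ.+ d) ℤ.+ e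
    lem = solve-∀

  -- The product peels off the head of its left factor; the induction for commutativity needs the
  -- same for the right factor.
  *-tailʳ : ∀ f g n → (f * g) (suc n) ≡ (f * tail g) n ℤ.+ f (suc n) ℤ.* g 0
  *-tailʳ f g zero    = lem (f 0) (g 1) (f 1) (g 0)
    where
    lem : ∀ a b c d → a ℤ.* b ℤ.+ (c ℤ.* d ℤ.+ + 0) ≡ (a ℤ.* b ℤ.+ + 0) ℤ.+ c ℤ.* d
    lem = solve-∀
  *-tailʳ f g (suc n) = trans (cong (λ z → f 0 ℤ.* g (suc (suc n)) ℤ.+ z) (*-tailʳ (tail f) g n))
    (sym (ℤ.+-assoc (f 0 ℤ.* g (suc (suc n))) ((tail f * tail g) n) (f (suc (suc n)) ℤ.* g 0)))

  *-comm : ∀ f g → f * g ≈ g * f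
  *-comm f g zero    = cong (λ z → z ℤ.+ + 0) (ℤ.*-comm (f 0) (g 0))
  *-comm f g (suc n) = trans (ℤ.+-comm (f 0 ℤ.* g (suc n)) _)
    (trans (cong₂ ℤ._+_ (*-comm (tail f) g n) (ℤ.*-comm (f 0) (g (suc n)))) (sym (*-tailʳ g f n)))

  0ˢ-* : ∀ f → 0ˢ * f ≈ 0ˢ
  0ˢ-* f zero    = cong (λ z → z ℤ.+ + 0) (ℤ.*-zeroˡ (f 0))
  0ˢ-* f (suc n) = cong₂ ℤ._+_ (ℤ.*-zeroˡ (f (suc n))) (0ˢ-* f n)

  const-* : ∀ c f → const c * f ≈ c · f
  const-* c f zero    = ℤ.+-identityʳ (c ℤ.* f 0)
  const-* c f (suc n) = trans (cong (λ z → c ℤ.* f (suc n) ℤ.+ z) (0ˢ-* f n)) (ℤ.+-identityʳ (c ℤ.* f (suc n)))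

  *-identityˡ : ∀ f → 1# * f ≈ f
  *-identityˡ f n = trans (const-* (+ 1) f n) (ℤ.*-identityˡ (f n))

  +-isAbelianGroup : IsAbelianGroup _≈_ _+_ 0# (RawRing.-_ powerSeriesRawRing)
  +-isAbelianGroup = record
    { isGroup = record
      { isMonoid = record
        { isSemigroup = record
          { isMagma = record
            { isEquivalence = Setoid.isEquivalence setoid
            ; ∙-cong = λ p q n → cong₂ ℤ._+_ (p n) (q n)
            }
          ; assoc = λ f g k n → ℤ.+-assoc (f n) (g n) (k n)
          }
        ; identity = comm∧idˡ⇒id +-comm λ f n → trans (cong (λ z → z ℤ.+ f n) (0#≈0ˢ n)) (ℤ.+-identityˡ (f n))
        }
      ; inverse = comm∧invˡ⇒inv +-comm λ f n → trans (ℤ.+-inverseˡ (f n)) (sym (0#≈0ˢ n))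
      ; ⁻¹-cong = λ p n → cong ℤ.-_ (p n)
      }
    ; comm = +-comm
    }
    where
    open Consequences setoid
    +-comm : ∀ f g → f + g ≈ g + f
    +-comm f g n = ℤ.+-comm (f n) (g n)

  isCommutativeRing : IsCommutativeRing _≈_ _+_ _*_ (RawRing.-_ powerSeriesRawRing) 0# 1#
  isCommutativeRing = record
    { isRing = record
      { +-isAbelianGroup = +-isAbelianGroup
      ; *-cong           = *-cong
      ; *-assoc          = *-assoc
      ; *-identity       = comm∧idˡ⇒id *-comm *-identityˡ
      ; distrib          = comm∧distrʳ⇒distr (IsAbelianGroup.∙-cong +-isAbelianGroup) *-comm *-distribʳ-+
      }
    ; *-comm = *-comm
    }
    where open Consequences setoid

  powerSeriesRing : CommutativeRing 0ℓ 0ℓ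
  powerSeriesRing = record { isCommutativeRing = isCommutativeRing }

  -- Lets the ring solver compute with integer coefficients, whose equality is decidable.
  const-morphism : ℤ.+-*-rawRing -Raw-AlmostCommutative⟶ fromCommutativeRing powerSeriesRing
  const-morphism = record
    { ⟦_⟧    = const
    ; +-homo = λ { a b zero → refl ; a b (suc _) → refl }
    ; *-homo = λ { a b zero → sym (const-* a (const b) zero)
                 ; a b (suc n) → sym (trans (const-* a (const b) (suc n)) (ℤ.*-zeroʳ a)) }
    ; -‿homo = λ { a zero → refl ; a (suc _) → refl }
    ; 0-homo = λ _ → refl
    ; 1-homo = λ _ → refl
    }

-- Fractions, expansions and the numerator, over any commutative ring.

module RingLemmas where

  open import Algebra.Bundles using (CommutativeRing)
  open import Algebra.Solver.Ring.AlmostCommutativeRing using (fromCommutativeRing; _-Raw-AlmostCommutative⟶_; Induced-equivalence)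
  import Data.Integer.Base as ℤ
  import Data.Integer.Properties as ℤ
  import Data.Maybe.Base as Maybe
  import Relation.Binary.PropositionalEquality as ≡
  open import Relation.Nullary.Decidable using (dec⇒maybe)
  open import Relation.Binary.Definitions using (WeaklyDecidable)
  import Algebra.Solver.Ring
  import Algebra.Properties.Semiring.Exp
  import Algebra.Properties.Semiring.Sum
  open import Data.Fin.Base using (Fin; toℕ)
  open import Data.Nat.Base as ℕ using (ℕ; zero; suc; _∸_) renaming (_+_ to _+ℕ_; _*_ to _*ℕ_)
  import Data.Nat.Properties as ℕ
  open import Function.Base using (_∘_)

  module OverRing {c ℓ} (R : CommutativeRing c ℓ)
    (morphism : ℤ.+-*-rawRing -Raw-AlmostCommutative⟶ fromCommutativeRing R) where

    open CommutativeRing R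
    open Algebra.Properties.Semiring.Exp semiring using (_^_; ^-homo-*; ^-congʳ)
    open Algebra.Properties.Semiring.Sum semiring using (sum; *-distribˡ-sum; sum-cong-≋)
    open import Algebra.Properties.CommutativeSemigroup *-commutativeSemigroup using (x∙yz≈y∙xz)
    open _-Raw-AlmostCommutative⟶_ morphism using (⟦_⟧)

    ⟦⟧-≟ : WeaklyDecidable (Induced-equivalence morphism)
    ⟦⟧-≟ a b = Maybe.map (λ { ≡.refl → refl }) (dec⇒maybe (a ℤ.≟ b))

    open import Relation.Binary.Reasoning.Setoid setoid
    open Algebra.Solver.Ring ℤ.+-*-rawRing (fromCommutativeRing R) morphism ⟦⟧-≟
      using (solve; _:+_; _:*_; _:-_; _:=_; _:^_)

    invertible-* : ∀ {x y u v} → x * u ≈ 1# → y * v ≈ 1# → x * y * (u * v) ≈ 1#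
    invertible-* {x} {y} {u} {v} p q = begin
      x * y * (u * v)   ≈⟨ solve 4 (λ x y u v → x :* y :* (u :* v) := x :* u :* (y :* v)) refl x y u v ⟩
      x * u * (y * v)   ≈⟨ *-cong p q ⟩
      1# * 1#           ≈⟨ *-identityˡ 1# ⟩
      1#                ∎

    divide : ∀ {f g d u} → f * d ≈ g → d * u ≈ 1# → f ≈ g * u
    divide {f} {g} {d} {u} p q = begin
      f           ≈⟨ *-identityʳ f ⟨
      f * 1#      ≈⟨ *-congˡ q ⟨
      f * (d * u) ≈⟨ *-assoc f d u ⟨
      f * d * u   ≈⟨ *-congʳ p ⟩
      g * u       ∎

    subtract : ∀ {f g k} → f ≈ g + k → f - k ≈ g
    subtract {f} {g} {k} p = trans (+-congʳ p) (trans (+-assoc g k (- k))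
      (trans (+-congˡ (-‿inverseʳ k)) (+-identityʳ g)))

    telescope : ∀ {f g} x → f ≈ g + x * f → f * (1# - x) ≈ g
    telescope {f} {g} x p = begin
      f * (1# - x)     ≈⟨ lem ⟩
      f - x * f        ≈⟨ subtract p ⟩
      g                ∎
      where
      lem : f * (1# - x) ≈ f - x * f
      lem = trans (distribˡ f 1# (- x)) (+-cong (*-identityʳ f)
              (trans (sym (-‿distribʳ-* f x)) (-‿cong (*-comm f x))))
        where open import Algebra.Properties.Ring ring

    -- a is X ^ (h - 1), and Σ, t are the series with coefficients s (h - 1) L and
    -- s (h - 1) (L + 1); all unknowns but x, a, S, S′, U, t are eliminated.
    recurrence-identity : ∀ {x a S S′ S″ U V₀ V₁ V₂ Σ t b xh xh+1 x2h-1 B} →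
      xh ≈ x * a → xh+1 ≈ x * (x * a) → x2h-1 ≈ x * (a * a) → B ≈ x2h-1 * b →
      S ≈ V₂ + x * x2h-1 * S″ → S ≈ V₁ + xh * S′ → S ≈ V₀ + a * U →
      S″ + x * S ≈ S′ + U + t + Σ → Σ ≈ 1# + x * t → Σ ≈ b + a * Σ →
      S * ((1# - a) * (1# - xh) * (1# - xh+1))
        ≈ (1# - a) * (V₂ - V₁ * xh - V₀ * xh+1 - x2h-1) + (1# + x) * B
    recurrence-identity {x} {a} {S} {S′} {S″} {U} {V₀} {V₁} {V₂} {Σ} {t} {b} {xh} {xh+1} {x2h-1} {B}
      xh≈ xh+1≈ x2h-1≈ B≈ V₂≈ V₁≈ V₀≈ rec Σ≈ b≈ = begin
      S * ((1# - a) * (1# - xh) * (1# - xh+1))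
        ≈⟨ *-congˡ (*-cong (*-congˡ (+-congˡ (-‿cong xh≈))) (+-congˡ (-‿cong xh+1≈))) ⟩
      -- Here q is X^(2h-1). Since x(t + σ) + 1 = (1 + x)σ, the terms in t and σ cancel against (1 +
      -- x)q(1 - a)σ; this accounts for both -X^(2h-1) and (1 + X)B in the numerator.
      S * ((1# - a) * (1# - x * a) * (1# - x * (x * a)))
        -- 1 is written x :^ 0 because con (+ 1) denotes ⟦ + 1 ⟧, not 1#.
        ≈⟨ solve 6 (λ x a S S′ U t →
             let one = x :^ 0
                 σ = one :+ x :* t
                 q = x :* (a :* a)
             in S :* ((one :- a) :* (one :- x :* a) :* (one :- x :* (x :* a)))
             := (one :- a) :* (S :- x :* q :* (S′ :+ U :+ t :+ σ :- x :* S)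
                                 :- (S :- x :* a :* S′) :* (x :* a) :- (S :- a :* U) :* (x :* (x :* a)) :- q)
                :+ (one :+ x) :* (q :* (σ :- a :* σ)))
           refl x a S S′ U t ⟩
      (1# - a) * (S - x * q * (S′ + U + t + σ - x * S)
                    - (S - x * a * S′) * (x * a) - (S - a * U) * (x * (x * a)) - q)
        + (1# + x) * (q * (σ - a * σ))
        ≈⟨ +-cong (*-congˡ (+-cong (+-cong (+-cong V₂≈′ (-‿cong (*-cong V₁≈′ (sym xh≈))))
             (-‿cong (*-cong (subtract V₀≈) (sym xh+1≈)))) (-‿cong (sym x2h-1≈))))
             (*-congˡ (sym (trans B≈ (*-cong x2h-1≈ b≈′)))) ⟩
      (1# - a) * (V₂ - V₁ * xh - V₀ * xh+1 - x2h-1) + (1# + x) * B ∎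
      where
      σ = 1# + x * t
      q = x * (a * a)
      V₁≈′ : S - x * a * S′ ≈ V₁
      V₁≈′ = subtract (trans V₁≈ (+-congˡ (*-congʳ xh≈)))
      b≈′ : b ≈ σ - a * σ
      b≈′ = sym (subtract (trans (sym Σ≈) (trans b≈ (+-congˡ (*-congˡ Σ≈)))))
      S″≈ : S″ ≈ S′ + U + t + σ - x * S
      S″≈ = sym (subtract (trans (+-congˡ (sym Σ≈)) (sym rec)))
      V₂≈′ : S - x * q * (S′ + U + t + σ - x * S) ≈ V₂
      V₂≈′ = subtract (trans V₂≈ (+-congˡ (*-cong (*-congˡ x2h-1≈) S″≈)))

    -- Serves to factor X^(2h-1) out of `B`. The exponent is a function e because the one in `B` is
    -- written with truncated subtraction.
    shift-sum : ∀ x (c : ℕ → Carrier) k m (e : ℕ → ℕ) → (∀ i → e i ≡.≡ m +ℕ i) →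
      sum (λ (i : Fin k) → c (toℕ i) * x ^ e (toℕ i)) ≈ x ^ m * sum (λ (i : Fin k) → c (toℕ i) * x ^ toℕ i)
    shift-sum x c k m e e≡ = sym (trans (*-distribˡ-sum {k} (x ^ m) (λ i → c (toℕ i) * x ^ toℕ i))
      (sum-cong-≋ {k} λ i → trans (x∙yz≈y∙xz (x ^ m) (c (toℕ i)) (x ^ toℕ i))
        (*-congˡ (trans (sym (^-homo-* x m (toℕ i))) (^-congʳ x (≡.sym (e≡ (toℕ i))))))))

    -- An abstract Taylor expansion: F j stands for a series without its first j coefficients.
    expansion : ∀ x (F c : ℕ → Carrier) → (∀ j → F j ≈ c j + x * F (suc j)) → ∀ k →
      F 0 ≈ sum (λ (i : Fin k) → c (toℕ i) * x ^ toℕ i) + x ^ k * F k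
    expansion x F c step zero    = sym (trans (+-identityˡ _) (*-identityˡ _))
    expansion x F c step (suc k) = begin
      F 0
        ≈⟨ step 0 ⟩
      c 0 + x * F 1
        ≈⟨ +-cong (sym (*-identityʳ (c 0))) (*-congˡ (expansion x (F ∘ suc) (c ∘ suc) (step ∘ suc) k)) ⟩
      c 0 * 1# + x * (rest + x ^ k * F (suc k))
        ≈⟨ +-congˡ (trans (distribˡ x _ _) (+-congˡ (sym (*-assoc x _ _)))) ⟩
      c 0 * 1# + (x * rest + x ^ suc k * F (suc k))
        ≈⟨ +-assoc _ _ _ ⟨
      c 0 * 1# + x * rest + x ^ suc k * F (suc k)
        ≈⟨ +-congʳ (+-congˡ (trans (*-distribˡ-sum {k} x (λ i → c (suc (toℕ i)) * x ^ toℕ i))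
             (sum-cong-≋ {k} λ i → x∙yz≈y∙xz x (c (suc (toℕ i))) (x ^ toℕ i)))) ⟩
      sum (λ (i : Fin (suc k)) → c (toℕ i) * x ^ toℕ i) + x ^ suc k * F (suc k) ∎
      where
      rest = sum (λ (i : Fin k) → c (suc (toℕ i)) * x ^ toℕ i)

    -- F j stands for x^j / (1 - x^(m+1)), so that F 0 = 1 + x^(m+1) F 0.
    geometric : ∀ x m (F : ℕ → Carrier) → F 0 ≈ 1# + x * F m → (∀ j → F (suc j) ≈ x * F j) →
      (1# - x ^ suc m) * F 0 ≈ 1#
    geometric x m F F₀ Fₛ = trans (*-comm _ _) (telescope (x ^ suc m) (begin
      F 0                      ≈⟨ F₀ ⟩
      1# + x * F m             ≈⟨ +-congˡ (*-congˡ (powers m)) ⟩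
      1# + x * (x ^ m * F 0)   ≈⟨ +-congˡ (*-assoc x (x ^ m) (F 0)) ⟨
      1# + x ^ suc m * F 0     ∎))
      where
      powers : ∀ j → F j ≈ x ^ j * F 0
      powers zero    = sym (*-identityˡ (F 0))
      powers (suc j) = trans (Fₛ j) (trans (*-congˡ (powers j)) (sym (*-assoc x (x ^ j) (F 0))))

    -- S′, S″ and U stand for S without its first h, 2h and h - 1 coefficients, t for the tail of Σ,
    -- and b for one period of Σ.
    recurrence⇒fraction : ∀ x n (S S′ S″ U V₀ V₁ V₂ Σ t b B : Carrier) → let h = suc (suc n) in
      B ≈ x ^ (2 *ℕ h ∸ 1) * b →
      S ≈ V₂ + x ^ (2 *ℕ h) * S″ → S ≈ V₁ + x ^ h * S′ → S ≈ V₀ + x ^ suc n * U →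
      S″ + x * S ≈ S′ + U + t + Σ → Σ ≈ 1# + x * t → Σ ≈ b + x ^ suc n * Σ →
      S * ((1# - x ^ suc n) * (1# - x ^ h) * (1# - x ^ (h +ℕ 1)))
        ≈ (1# - x ^ suc n) * (V₂ - V₁ * x ^ h - V₀ * x ^ (h +ℕ 1) - x ^ (2 *ℕ h ∸ 1)) + (1# + x) * B
    recurrence⇒fraction x n S S′ S″ U V₀ V₁ V₂ Σ t b B B≈ V₂≈ V₁≈ V₀≈ rec Σ≈ b≈ =
      recurrence-identity {x = x} {a = x ^ suc n} refl (^-congʳ x (ℕ.+-comm h 1)) x2h-1≈
        B≈ V₂≈ V₁≈ V₀≈ rec Σ≈ b≈
      where
      h = suc (suc n)
      x2h-1≈ : x ^ (2 *ℕ h ∸ 1) ≈ x * (x ^ suc n * x ^ suc n)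
      x2h-1≈ = begin
        x ^ (2 *ℕ h ∸ 1)            ≈⟨ ^-congʳ x (≡.trans (≡.cong (suc n +ℕ_) (ℕ.+-identityʳ h)) (ℕ.+-suc (suc n) (suc n))) ⟩
        x * x ^ (suc n +ℕ suc n)    ≈⟨ *-congˡ (^-homo-* x (suc n) (suc n)) ⟩
        x * (x ^ suc n * x ^ suc n) ∎

    square-inverse : ∀ x g → (1# - x ^ 1) * g ≈ 1# → (1# - x) ^ 2 * (g * g) ≈ 1#
    square-inverse x g p = invertible-* p′ (trans (*-congʳ (*-identityʳ _)) p′)
      where
      p′ : (1# - x) * g ≈ 1#
      p′ = trans (*-congʳ (+-congˡ (-‿cong (sym (*-identityʳ x))))) p

    -- o stands for 1/(1 - x), with all coefficients 1, and n for 1/(1 - x)^2, with coefficients k +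
    -- 1; the two are linked by n = o + x n.
    linear⇒fraction : ∀ x s n o → s ≈ x * n → n ≈ 1# + x * (n + o) → o ≈ 1# + x * o → s * (1# - x) ^ 2 ≈ x
    linear⇒fraction x s n o s≈ n≈ o≈ = begin
      s * ((1# - x) * ((1# - x) * 1#)) ≈⟨ *-cong s≈ (*-congˡ (*-identityʳ (1# - x))) ⟩
      x * n * ((1# - x) * (1# - x))    ≈⟨ *-assoc (x * n) _ _ ⟨
      x * n * (1# - x) * (1# - x)      ≈⟨ *-congʳ (*-assoc x n _) ⟩
      x * (n * (1# - x)) * (1# - x)    ≈⟨ *-congʳ (*-congˡ (telescope x n≈′)) ⟩
      x * o * (1# - x)                 ≈⟨ *-assoc x o _ ⟩
      x * (o * (1# - x))               ≈⟨ *-congˡ (telescope x o≈) ⟩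
      x * 1#                           ≈⟨ *-identityʳ x ⟩
      x                                ∎
      where
      n≈′ : n ≈ o + x * n
      n≈′ = begin
        n                      ≈⟨ n≈ ⟩
        1# + x * (n + o)       ≈⟨ +-congˡ (trans (distribˡ x n o) (+-comm _ _)) ⟩
        1# + (x * o + x * n)   ≈⟨ +-assoc _ _ _ ⟨
        1# + x * o + x * n     ≈⟨ +-congʳ o≈ ⟨
        o + x * n              ∎

open Counting using (#⟨_,_⟩; #00-zero; #-height-zero; #-height-one; s-#; s-#00; s-periodic; s-recurrence)
open PowerSeriesRing using (tail; powerSeriesRing; const-morphism; *-identityˡ)
open import Defs
open import Data.Nat.Base using (ℕ; _≤_; _∸_) renaming (_+_ to _+ℕ_)
open import Data.Product.Base using (_×_)
open import Algebra.Bundles using (CommutativeRing)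
open import Data.Fin.Base using (Fin; toℕ)
open import Data.Fin.Patterns using (0F)
open import Data.Integer.Base as ℤ using (+_)
import Data.Integer.Properties as ℤ
open import Data.Nat.Base using (zero; suc; s≤s; z≤n) renaming (_*_ to _*ℕ_)
import Data.Nat.Properties as ℕ
open import Data.Product.Base using (_,_)
open import Relation.Binary.PropositionalEquality as ≡ using (_≡_)

-- Shifted series, geometric series and the three generating functions.

module R = CommutativeRing powerSeriesRing
open RingLemmas.OverRing powerSeriesRing const-morphism

X-*-suc : ∀ f n → (X * f) (suc n) ≡ f n
X-*-suc f n = ≡.trans
  (≡.cong₂ ℤ._+_ (ℤ.*-zeroˡ (f (suc n))) (≡.trans (R.*-cong {tail X} {1#} {f} {f} tail-X (λ _ → ≡.refl) n) (*-identityˡ f n)))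
  (ℤ.+-identityˡ (f n))
  where
  tail-X : tail X ≈ 1#
  tail-X zero    = ≡.refl
  tail-X (suc _) = ≡.refl

X-*-zero : ∀ f → (X * f) 0 ≡ + 0
X-*-zero f = ≡.trans (ℤ.+-identityʳ (+ 0 ℤ.* f 0)) (ℤ.*-zeroˡ (f 0))

head-tail : ∀ f → f ≈ const (f 0) + X * tail f
head-tail f zero    = ≡.sym (≡.trans (≡.cong (λ z → f 0 ℤ.+ z) (X-*-zero (tail f))) (ℤ.+-identityʳ (f 0)))
head-tail f (suc n) = ≡.sym (≡.trans (ℤ.+-identityˡ _) (X-*-suc (tail f) n))

taylor : ∀ f k → f ≈ sum (λ (i : Fin k) → const (f (toℕ i)) * X ^ toℕ i) + X ^ k * (λ n → f (n +ℕ k))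
taylor f k n = ≡.trans (≡.cong f (≡.sym (ℕ.+-identityʳ n)))
  (expansion X (λ j n → f (n +ℕ j)) (λ j → const (f j)) step k n)
  where
  step : ∀ j → (λ n → f (n +ℕ j)) ≈ const (f j) + X * (λ n → f (n +ℕ suc j))
  step j n = ≡.trans (head-tail (λ n → f (n +ℕ j)) n) (≡.cong (λ z → const (f j) n ℤ.+ z)
    (R.*-cong {X} {X} {λ n → f (suc n +ℕ j)} {λ n → f (n +ℕ suc j)}
      (λ _ → ≡.refl) (λ n → ≡.cong f (≡.sym (ℕ.+-suc n j))) n))

-- X ^ j / (1 - X ^ (m + 1))
X^_/[1-X^suc_] : ℕ → ℕ → PowerSeries
X^_/[1-X^suc_] zero    m zero    = + 1
X^_/[1-X^suc_] zero    m (suc n) = X^_/[1-X^suc_] m m n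
X^_/[1-X^suc_] (suc j) m zero    = + 0
X^_/[1-X^suc_] (suc j) m (suc n) = X^_/[1-X^suc_] j m n

geometric-series : ℕ → PowerSeries
geometric-series = X^_/[1-X^suc_] 0

geometric-inverse : ∀ m → (1# - X ^ suc m) * geometric-series m ≈ 1#
geometric-inverse m = geometric X m (λ j → X^_/[1-X^suc_] j m) (head-tail (geometric-series m)) step
  where
  step : ∀ j → X^_/[1-X^suc_] (suc j) m ≈ X * X^_/[1-X^suc_] j m
  step j n = ≡.trans (head-tail (X^_/[1-X^suc_] (suc j) m) n) (R.+-identityˡ (X * X^_/[1-X^suc_] j m) n)

quotient : ∀ f g d u → f * d ≈ g → d * u ≈ 1# → f ≈ g / d
quotient f g d u p q = (u , (λ n → ≡.trans (R.*-comm u d n) (q n)) , q) , divide {f} {g} {d} {u} p q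

𝓢₀ : 𝓢 0 ≈ 1# / 1# - X
𝓢₀ = quotient (𝓢 0) 1# (1# - X) (geometric-series 0)
  (telescope {𝓢 0} {1#} X step)
  (λ n → ≡.trans (R.*-cong {1# - X} {1# - X ^ 1} {geometric-series 0} {geometric-series 0}
      (R.+-congˡ {1#} (R.-‿cong {X} {X ^ 1} (R.sym {X ^ 1} {X} (R.*-identityʳ X)))) (λ _ → ≡.refl) n)
    (geometric-inverse 0 n))
  where
  ones : ∀ n → 𝓢 0 n ≡ + 1
  ones zero    = ≡.refl
  ones (suc n) = ≡.cong +_ (≡.trans (≡.cong (λ L → #𝕊 L 0) (≡.sym (ℕ.+-identityʳ (suc n)))) (#-height-zero (suc n)))
  step : 𝓢 0 ≈ 1# + X * 𝓢 0
  step n = ≡.trans (head-tail (𝓢 0) n) (≡.cong (λ z → 1# n ℤ.+ z)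
    (R.*-cong {X} {X} {tail (𝓢 0)} {𝓢 0} (λ _ → ≡.refl) (λ n → ≡.trans (ones (suc n)) (≡.sym (ones n))) n))

-- A single 1 may stand at any position, so `𝓢 1` is X times the series with coefficients n + 1.
𝓢₁ : 𝓢 1 ≈ X / (1# - X) ^ 2
𝓢₁ = quotient (𝓢 1) X ((1# - X) ^ 2) (geometric-series 0 * geometric-series 0)
  (linear⇒fraction X (𝓢 1) (λ n → + suc n) (λ _ → + 1) 𝓢≈
    (λ n → ≡.trans (head-tail (λ n → + suc n) n) (≡.cong (λ z → 1# n ℤ.+ z)
      (R.*-cong {X} {X} {λ n → + suc (suc n)} {λ n → + suc n ℤ.+ + 1} (λ _ → ≡.refl)
        (λ n → ≡.cong +_ (ℕ.+-comm 1 (suc n))) n)))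
    (head-tail (λ _ → + 1)))
  (square-inverse X (geometric-series 0) (geometric-inverse 0))
  where
  𝓢≈ : 𝓢 1 ≈ X * (λ n → + suc n)
  𝓢≈ n = ≡.trans (head-tail (𝓢 1) n) (≡.trans (R.+-identityˡ (X * tail (𝓢 1)) n)
    (R.*-cong {X} {X} {tail (𝓢 1)} {λ n → + suc n} (λ _ → ≡.refl)
      (λ n → ≡.cong +_ (≡.trans (≡.cong (λ L → s (+ L) (+ 1)) (ℕ.+-comm 1 n)) (≡.trans (s-# n 0) (#-height-one n)))) n))

𝓢ₕ : ∀ n → let h = suc (suc n) in
  𝓢 h ≈ 𝓕 h / (1# - X ^ suc n) * (1# - X ^ h) * (1# - X ^ (h +ℕ 1))
𝓢ₕ n = quotient (𝓢 h) (𝓕 h) ((1# - X ^ suc n) * (1# - X ^ h) * (1# - X ^ (h +ℕ 1)))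
  (geometric-series n * geometric-series (suc n) * geometric-series (suc (n +ℕ 1)))
  (recurrence⇒fraction X n (𝓢 h) (λ y → 𝓢 h (y +ℕ h)) (λ y → 𝓢 h (y +ℕ 2 *ℕ h)) (λ y → 𝓢 h (y +ℕ suc n))
    (V (suc n) h) (V h h) (V (2 *ℕ h) h) Σ (tail Σ) b (B h)
    (shift-sum X (λ r → const (Σ r)) (suc n) (2 *ℕ h ∸ 1) (λ r → r +ℕ 2 *ℕ h ∸ 1) exponent)
    (taylor (𝓢 h) (2 *ℕ h)) (taylor (𝓢 h) h) (taylor (𝓢 h) (suc n))
    -- Removing the first h - 1 coefficients of Σ leaves Σ, since s(h-1,-) has period h - 1.
    recurrence Σ≈ (λ y → ≡.trans (taylor Σ (suc n) y) (≡.cong (λ z → b y ℤ.+ z)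
      (R.*-cong {X ^ suc n} {X ^ suc n} {λ y → Σ (y +ℕ suc n)} {Σ} (λ _ → ≡.refl) (λ y → ≡.cong +_ (s-periodic n y)) y))))
  (invertible-* {(1# - X ^ suc n) * (1# - X ^ h)} {1# - X ^ (h +ℕ 1)}
     {geometric-series n * geometric-series (suc n)} {geometric-series (suc (n +ℕ 1))}
    (invertible-* {1# - X ^ suc n} {1# - X ^ h} {geometric-series n} {geometric-series (suc n)}
      (geometric-inverse n) (geometric-inverse (suc n)))
    last-factor)
  where
  h : ℕ
  h = suc (suc n)
  Σ b : PowerSeries
  Σ r = + s (+ suc n) (+ r)
  b = sum λ (r : Fin (suc n)) → const (Σ (toℕ r)) * X ^ toℕ r
  exponent : ∀ r → r +ℕ 2 *ℕ h ∸ 1 ≡ (2 *ℕ h ∸ 1) +ℕ r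
  exponent r = ≡.trans (ℕ.+-∸-assoc r {2 *ℕ h} {1} (s≤s z≤n)) (ℕ.+-comm r (2 *ℕ h ∸ 1))
  Σ≈ : Σ ≈ 1# + X * tail Σ
  Σ≈ n′ = ≡.trans (head-tail Σ n′) (≡.cong (λ z → const (+ z) n′ ℤ.+ (X * tail Σ) n′)
    (≡.trans (≡.cong (λ L → #𝕊 L 0) (≡.sym (ℕ.+-identityʳ (suc n)))) (#-height-zero (suc n))))
  -- The factor X realises the shift to s(y-1,h); its constant term 0 agrees with there being no
  -- word that starts with 0 but contains no 0.
  X*𝓢 : X * 𝓢 h ≈ λ y → + #⟨ 0F , 0F ⟩ y h
  X*𝓢 zero    = ≡.trans (X-*-zero (𝓢 h)) (≡.cong +_ (≡.sym (#00-zero h)))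
  X*𝓢 (suc y) = ≡.trans (X-*-suc (𝓢 h) y) (≡.cong +_ (s-#00 y (suc n)))
  recurrence : (λ y → 𝓢 h (y +ℕ 2 *ℕ h)) + X * 𝓢 h
               ≈ (λ y → 𝓢 h (y +ℕ h)) + (λ y → 𝓢 h (y +ℕ suc n)) + tail Σ + Σ
  recurrence y = ≡.trans (≡.cong₂ ℤ._+_ (≡.cong (𝓢 h) index) (X*𝓢 y)) (≡.cong +_ (s-recurrence y n))
    where
    index : y +ℕ 2 *ℕ h ≡ y +ℕ h +ℕ h
    index = ≡.trans (≡.cong (λ k → y +ℕ (h +ℕ k)) (ℕ.+-identityʳ h)) (≡.sym (ℕ.+-assoc y h h))
  last-factor : (1# - X ^ (h +ℕ 1)) * geometric-series (suc (n +ℕ 1)) ≈ 1#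
  last-factor = geometric-inverse (suc (n +ℕ 1))

theorem10 : (𝓢 0 ≈ 1# / 1# - X)
    × (𝓢 1 ≈ X / (1# - X) ^ 2)
    × (∀ (h : ℕ) → 2 ≤ h →
    𝓢 h ≈ 𝓕 h / (1# - X ^ (h ∸ 1)) * (1# - X ^ h) * (1# - X ^ (h +ℕ 1)))
theorem10 = 𝓢₀ , 𝓢₁ , λ { (suc (suc n)) _ → 𝓢ₕ n ; 1 (s≤s ()) }
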